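{- Let $r\in\mathcal{Y}_n$. Then the coproduct of $\mathit{LR}$ satisfies $$\Delta(M^*_r)=\sum_{\substack{\mathsf{R}\subseteq[n]\\ \lambda(\pi_\mathsf{R})\leq r}}M^*_{r|_\mathsf{R}}\otimes M^*_{r|_{\mathsf{R}^c}}.$$
   Context: Permutations in one-line notation; $\mathfrak{S}_n$ with weak order (inclusion of inversion sets); st = standardization; $(\sigma\cdot\zeta)(i)=\sigma(\zeta(i))$; $\sigma/\tau$ has values $\sigma(1),\dots,\sigma(p),\tau(1)+p,\dots,\tau(q)+p$; $\sigma\vee\tau$ has values $\sigma(1)+q,\dots,\sigma(p)+q,p+q+1,\tau(1),\dots,\tau(q)$; $\mathrm{Sh}(p,q)$ = permutations of $[p+q]$ with no descent except possibly at $p$. $\mathcal{Y}_n$: rooted planar binary trees with $n$ internal nodes, $\mathcal{Y}_0=\{|\}$, $t=t_l\vee t_r$ uniquely; Tamari order generated by replacing a subtree $(A\vee B)\vee C$ by $A\vee(B\vee C)$. $\lambda(\mathrm{id}_0)=|$, $\lambda(\sigma)=\lambda(\mathrm{st}(\sigma(1..j-1)))\vee\lambda(\mathrm{st}(\sigma(j+1..n)))$ with $j=\sigma^{ -1}(n)$; $\gamma(|)=\mathrm{id}_0$, $\gamma(t)=\gamma(t_l)\vee\gamma(t_r)$. For $\mathsf{R}=\{R_1<\dots<R_p\}\subseteq[n]$ with complement $\mathsf{R}^c=\{R^c_1<\dots<R^c_q\}$: $\pi_\mathsf{R}\in\mathfrak{S}_n$ is defined by $\pi_\mathsf{R}(R_i)=i$,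 $\pi_\mathsf{R}(R^c_i)=p+i$; $\rho|_\mathsf{R}=\mathrm{st}(\rho(R_1),\dots,\rho(R_p))$ for $\rho\in\mathfrak{S}_n$; $r|_\mathsf{R}=\lambda(\gamma(r)|_\mathsf{R})$ for $r\in\mathcal{Y}_n$ (similarly for $\mathsf{R}^c$). $\mathcal{Y}Sym$: graded Hopf algebra over $\mathbb{Q}$ with basis $F_t$, product $F_s\cdot F_t=\sum_{\zeta\in\mathrm{Sh}(p,q)}F_{\lambda((\gamma(s)/\gamma(t))\cdot\zeta^{ -1})}$ and coproduct $\Delta F_t=\sum_iF_{\lambda(\mathrm{st}(\gamma(t)(1..i)))}\otimes F_{\lambda(\mathrm{st}(\gamma(t)(i+1..n)))}$; monomial basis $M_t=\sum_{s\ge t}\mu_{\mathcal{Y}_n}(t,s)F_s$. $\mathit{LR}$ is the graded dual of $\mathcal{Y}Sym$ and $\{M^*_t\}$ the basis dual to $\{M_t\}$. -}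

module Defs where

open import Data.Bool using (Bool; true; false; if_then_else_; not; _∧_; _∨_)
open import Data.Nat using (ℕ; zero; suc; _+_; _∸_; _≡ᵇ_; _<ᵇ_; _≤ᵇ_)
open import Data.List using (List; []; _∷_; _++_; map; concatMap; filter; length; foldr; upTo)
open import Data.Bool.ListAction using (any; all)
open import Data.Integer using (+_)
open import Data.Rational using (ℚ; 0ℚ; 1ℚ; _/_; -_) renaming (_+_ to _+q_; _*_ to _*q_)
open import Relation.Nullary.Decidable using (yes; no)

-- Permutations in one-line notation, as lists of values 1..n.

Perm : Set
Perm = List ℕ

countLess : ℕ → List ℕ → ℕ
countLess x [] = 0
countLess x (y ∷ ys) = if y <ᵇ x then suc (countLess x ys) else countLess x ys

-- standardization (entries assumed distinct)
st : List ℕ → Perm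
st xs = map (λ x → suc (countLess x xs)) xs

maxL : List ℕ → ℕ
maxL [] = 0
maxL (x ∷ xs) = Data.Nat._⊔_ x (maxL xs)

record Split : Set where
  constructor _,,_
  field before after : List ℕ

splitAt : ℕ → List ℕ → Split
splitAt m [] = [] ,, []
splitAt m (x ∷ xs) with x ≡ᵇ m
... | true = [] ,, xs
... | false with splitAt m xs
... | b ,, a = (x ∷ b) ,, a

-- 1-indexed lookup (0 if out of range)
at : List ℕ → ℕ → ℕ
at [] _ = 0
at (x ∷ xs) zero = 0
at (x ∷ xs) (suc zero) = x
at (x ∷ xs) (suc (suc i)) = at xs (suc i)

-- 1-indexed position of value v in xs (0 if absent)
pos : ℕ → List ℕ → ℕ
pos v [] = 0
pos v (x ∷ xs) = if x ≡ᵇ v then 1 else (if pos v xs ≡ᵇ 0 then 0 else suc (pos v xs))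

oneTo : ℕ → List ℕ
oneTo n = map suc (upTo n)

infixr 5 _⋁_
data BT : Set where
  leaf : BT
  _⋁_  : BT → BT → BT

size : BT → ℕ
size leaf = 0
size (l ⋁ r) = suc (size l + size r)

eqBT : BT → BT → Bool
eqBT leaf leaf = true
eqBT leaf (_ ⋁ _) = false
eqBT (_ ⋁ _) leaf = false
eqBT (a ⋁ b) (c ⋁ d) = eqBT a c ∧ eqBT b d

upToTrees : ℕ → List BT
upToTrees zero = leaf ∷ []
upToTrees (suc n) = leaf ∷ concatMap (λ l → concatMap (λ r →
    if (size l + size r) ≤ᵇ n then (l ⋁ r) ∷ [] else []) (upToTrees n)) (upToTrees n)

𝒴 : ℕ → List BT
𝒴 n = filter (λ t → Data.Nat._≟_ (size t) n) (upToTrees n)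

-- λ with fuel (fuel = length suffices)
lamF : ℕ → Perm → BT
lamF zero _ = leaf
lamF (suc k) [] = leaf
lamF (suc k) (x ∷ xs) with splitAt (maxL (x ∷ xs)) (x ∷ xs)
... | b ,, a = lamF k (st b) ⋁ lamF k (st a)

lam : Perm → BT
lam σ = lamF (length σ) σ

veeP : Perm → Perm → Perm
veeP σ τ = map (λ x → x + length τ) σ ++ (suc (length σ + length τ) ∷ τ)

gam : BT → Perm
gam leaf = []
gam (l ⋁ r) = veeP (gam l) (gam r)

slash : Perm → Perm → Perm
slash σ τ = σ ++ map (λ x → x + length σ) τ

inv : Perm → Perm
inv ζ = map (λ i → pos i ζ) (oneTo (length ζ))

compose : Perm → Perm → Perm
compose σ ζ = map (at σ) ζ

insertAll : ℕ → Perm → List Perm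
insertAll v [] = (v ∷ []) ∷ []
insertAll v (x ∷ xs) = (v ∷ x ∷ xs) ∷ map (x ∷_) (insertAll v xs)

perms : ℕ → List Perm
perms zero = [] ∷ []
perms (suc n) = concatMap (insertAll (suc n)) (perms n)

isShuffle : ℕ → Perm → Bool
isShuffle p ζ = all (λ i → (i ≡ᵇ p) ∨ (at ζ i <ᵇ at ζ (suc i))) (oneTo (length ζ ∸ 1))

Sh : ℕ → ℕ → List Perm
Sh p q = filter (λ ζ → Data.Bool._≟_ (isShuffle p ζ) true) (perms (p + q))

rotations : BT → List BT
rotations leaf = []
rotations (leaf ⋁ c) = map (leaf ⋁_) (rotations c)
rotations ((a ⋁ b) ⋁ c) = (a ⋁ (b ⋁ c)) ∷ (map (_⋁ c) (rotations (a ⋁ b)) ++ map ((a ⋁ b) ⋁_) (rotations c))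

reach : ℕ → BT → List BT
reach zero s = s ∷ []
reach (suc k) s = s ∷ concatMap (reach k) (rotations s)

-- s ≤ t in the Tamari order.  A path in a graph with N vertices can be
-- shortened to one with < N steps, and 𝒴_{size s} has N = length (𝒴 (size s)) elements.
_≤T_ : BT → BT → Bool
s ≤T t = any (eqBT t) (reach (length (𝒴 (size s))) s)

sumℚ : List ℚ → ℚ
sumℚ = foldr _+q_ 0ℚ

ℕtoℚ : ℕ → ℚ
ℕtoℚ k = (+ k) / 1

-- Möbius function of the Tamari order on 𝒴ₙ:
-- μ(s,s) = 1, μ(s,u) = - Σ_{s ≤ v < u} μ(s,v) for s < u, 0 if s ≰ u.
-- Fuel = number of trees bounds the length of any strict chain.
muF : ℕ → BT → BT → ℚ
muF k s u with eqBT s u | s ≤T u | k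
... | true  | _     | _ = 1ℚ
... | false | false | _ = 0ℚ
... | false | true  | zero = 0ℚ
... | false | true  | suc k' = - sumℚ (map (λ v → if (s ≤T v) ∧ ((v ≤T u) ∧ not (eqBT v u)) then muF k' s v else 0ℚ) (𝒴 (size s)))

μ : BT → BT → ℚ
μ s u = muF (length (𝒴 (size s))) s u

-- 𝒴Sym: elements are coordinate functions in the F basis (coefficient of F_u).

Vect : Set
Vect = BT → ℚ

_+v_ : Vect → Vect → Vect
(x +v y) u = x u +q y u

_·v_ : ℚ → Vect → Vect
(c ·v x) u = c *q x u

-- coefficient of F_u in F_s · F_t
prodF : BT → BT → BT → ℚ
prodF s t u = ℕtoℚ (length (filter (λ ζ → Data.Bool._≟_ (eqBT (lam (compose (slash (gam s) (gam t)) (inv ζ))) u) true) (Sh (size s) (size t))))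

_⋆_ : Vect → Vect → Vect
(x ⋆ y) u = sumℚ (map (λ p → sumℚ (map (λ s → sumℚ (map (λ t → (x s *q y t) *q prodF s t u)
               (𝒴 (size u ∸ p)))) (𝒴 p))) (upTo (suc (size u))))

-- monomial basis M_t = Σ_{s ≥ t} μ(t,s) F_s
M : BT → Vect
M t u = μ t u

δ : BT → BT → ℚ
δ r u = if eqBT r u then 1ℚ else 0ℚ

-- Subsets R ⊆ [n] as characteristic lists of length n

subsets : ℕ → List (List Bool)
subsets zero = [] ∷ []
subsets (suc n) = concatMap (λ b → (true ∷ b) ∷ (false ∷ b) ∷ []) (subsets n)

countTrue : List Bool → ℕ
countTrue [] = 0
countTrue (true ∷ bs) = suc (countTrue bs)
countTrue (false ∷ bs) = countTrue bs

piAux : List Bool → ℕ → ℕ → ℕ → Perm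
piAux [] p i j = []
piAux (true ∷ bs) p i j = suc i ∷ piAux bs p (suc i) j
piAux (false ∷ bs) p i j = (p + suc j) ∷ piAux bs p i (suc j)

piR : List Bool → Perm
piR b = piAux b (countTrue b) 0 0

select : List Bool → List ℕ → List ℕ
select [] _ = []
select (_ ∷ _) [] = []
select (true ∷ bs) (x ∷ xs) = x ∷ select bs xs
select (false ∷ bs) (x ∷ xs) = select bs xs

restrictP : Perm → List Bool → Perm
restrictP ρ b = st (select b ρ)

restrictT : BT → List Bool → BT
restrictT r b = lam (restrictP (gam r) b)

complement : List Bool → List Bool
complement = map not

{-# OPTIONS --safe #-}
-- Since F_t = Σ_{r ≥ t} M_r, the coefficient of M_r in F_s · F_t is the number of
-- shuffles ζ with λ((γ(s)/γ(t)) · ζ⁻¹) ≤ r.  Here λ(ω) ≤ r holds exactly when ω,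
-- written on the nodes of r in infix order, gives every node a larger label than
-- its left descendants.  Shuffles correspond to subsets R ⊆ [n] by ζ⁻¹ = π_R, and
-- all labels at R are smaller than those at the complement Rᶜ, so the condition
-- splits into one on mixed pairs of nodes, which is λ(π_R) ≤ r, and one on R and
-- on Rᶜ separately, which is s ≤ r|_R and t ≤ r|_{Rᶜ}.  Möbius inversion in s and t
-- turns the last two into s = r|_R and t = r|_{Rᶜ}.

module Submission where

open import Algebra.Bundles using (CommutativeRing)
import Algebra.Properties.CommutativeSemigroup as CommutativeSemigroupProperties
open import Defs
open import Data.Bool.Base using (Bool; true; false; if_then_else_; not; _∧_; T)
open import Data.Bool.Properties as Bool using (T-∧; T-∨; T-≡; ⇔→≡)
open import Data.Integer.Base using () renaming (+_ to posℤ)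
import Data.Integer.Base as ℤ
import Data.Integer.Properties as ℤ
open import Data.List.Base using (List; []; _∷_; _++_; map; concatMap; filter; length; upTo)
open import Data.List.Membership.Propositional using (_∈_; lose; find)
open import Data.List.Membership.Propositional.Properties using (∈-map⁺; ∈-map⁻; ∈-++⁺ˡ; ∈-++⁺ʳ; ∈-++⁻; ∈-concatMap⁺; ∈-concatMap⁻; ∈-filter⁺; ∈-filter⁻; ∈-∃++; ∈-insert; ∈-upTo⁺; ∈-upTo⁻)
open import Data.List.Membership.Propositional.Properties.WithK using (unique∧set⇒bag)
open import Data.List.Properties using (length-map; length-++; length-filter; map-∘; map-id; map-cong-local; map-++; length-upTo; upTo-∷ʳ; ++-identityʳ; ++-conicalˡ; ++-conicalʳ; ++-assoc; ∷-injective; ∷-injectiveˡ; ∷-injectiveʳ)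
open import Data.List.Relation.Binary.BagAndSetEquality using (∼bag⇒↭)
open import Data.List.Relation.Binary.Permutation.Propositional as ↭ using (_↭_; ↭-sym; ↭-trans; ↭-reflexive; prep; ↭⇒↭ₛ)
open import Data.List.Relation.Binary.Permutation.Propositional.Properties using (∈-resp-↭; drop-mid; drop-∷; shift; ↭-length; map⁺; ↭-empty-inv)
import Data.List.Relation.Binary.Permutation.Setoid.Properties as Permutationₛ
open import Data.List.Relation.Unary.All as All using (All; []; _∷_)
import Data.List.Relation.Unary.All.Properties as All
open import Data.List.Relation.Unary.AllPairs as AllPairs using (AllPairs; []; _∷_)
import Data.List.Relation.Unary.AllPairs.Properties as AllPairs
open import Data.List.Relation.Unary.Any using (here; there)
import Data.List.Relation.Unary.Any.Properties as Any
open import Data.List.Relation.Unary.Linked using (Linked; []; [-]; _∷_)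
open import Data.List.Relation.Unary.Linked.Properties using (AllPairs⇒Linked; Linked⇒AllPairs)
open import Data.List.Relation.Unary.Unique.Propositional using (Unique)
import Data.List.Relation.Unary.Unique.Propositional.Properties as Unique
open import Data.Nat.Base as ℕ using (ℕ; zero; suc; _∸_; _≡ᵇ_; _<ᵇ_; _≤ᵇ_; _≤_; _<_; z≤n; s≤s)
open import Data.Nat.Properties as ℕ using (≤-refl; ≤-trans; <-trans; <-irrefl; <⇒≤; ≤-<-trans; <-≤-trans; suc-injective)
open import Data.Product.Base using (∃; _×_; _,_; proj₁; proj₂; ∃₂)
open import Data.Rational using (ℚ; 0ℚ; 1ℚ; _+_; _*_; -_; toℚᵘ)
import Data.Rational.Properties as ℚ
import Data.Rational.Unnormalised.Base as ℚᵘ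
import Data.Rational.Unnormalised.Properties as ℚᵘ
open import Data.Sum.Base using (_⊎_; inj₁; inj₂)
open import Data.Unit.Base using (⊤; tt)
open import Function.Base using (_∘_; id; case_of_)
open import Function.Bundles using (_⇔_; mk⇔; Equivalence)
open import Relation.Binary.Construct.Closure.ReflexiveTransitive as Star using (Star; ε; _◅_; _◅◅_)
open import Relation.Binary.PropositionalEquality using (_≡_; _≢_; _≗_; refl; sym; trans; cong; cong₂; subst; subst₂; module ≡-Reasoning)
open import Relation.Binary.PropositionalEquality.Properties using (setoid)
open import Relation.Nullary.Decidable using (Dec; yes; no; map′; T?)
open import Relation.Nullary.Negation using (¬_; contradiction)

open Equivalence using (to; from)

-- Trees and rotations

-- The weak order on permutations never appears. `Fits` replaces it because it sees only comparisons
-- of a node with its left descendants: standardization, shifts and rotations preserve it, and both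
-- λ and γ are characterised by it. Every Tamari comparison can thus be traded for comparisons of
-- labels. Two obstacles shape the rest. The order and its Möbius function are computed with fuel,
-- which must be shown to suffice; `weight`, lowered by every rotation, bounds all chains. And a
-- vector is an arbitrary function on trees, whereas linearity of `D r` reaches only finite sums.
-- Hence each vector that occurs is shown to live in one degree, where it is a finite combination of
-- the F basis, and the values of `D r` on that basis are recovered from those on the M basis.

infix 4 _⟶_ _≼_

data _⟶_ : BT → BT → Set where
  rotate : ∀ {a b c} → (a ⋁ b) ⋁ c ⟶ a ⋁ (b ⋁ c)
  left   : ∀ {a a′ c} → a ⟶ a′ → a ⋁ c ⟶ a′ ⋁ c
  right  : ∀ {a c c′} → c ⟶ c′ → a ⋁ c ⟶ a ⋁ c′

_≼_ : BT → BT → Set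
_≼_ = Star _⟶_

⋁-mono-≼ : ∀ {a a′ c c′} → a ≼ a′ → c ≼ c′ → a ⋁ c ≼ a′ ⋁ c′
⋁-mono-≼ p q = Star.gmap (_⋁ _) left p ◅◅ Star.gmap (_ ⋁_) right q

∈-rotations⁺ : ∀ {s t} → s ⟶ t → t ∈ rotations s
∈-rotations⁺ rotate                      = here refl
∈-rotations⁺ (left {a = a ⋁ b} p)        = there (∈-++⁺ˡ (∈-map⁺ (_⋁ _) (∈-rotations⁺ p)))
∈-rotations⁺ (right {a = leaf} p)        = ∈-map⁺ (leaf ⋁_) (∈-rotations⁺ p)
∈-rotations⁺ (right {a = a ⋁ b} {c} p)   =
  there (∈-++⁺ʳ (map (_⋁ c) (rotations (a ⋁ b))) (∈-map⁺ (_ ⋁_) (∈-rotations⁺ p)))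

∈-rotations⁻ : ∀ s {t} → t ∈ rotations s → s ⟶ t
∈-rotations⁻ (leaf ⋁ c) i with _ , j , refl ← ∈-map⁻ (leaf ⋁_) i = right (∈-rotations⁻ c j)
∈-rotations⁻ ((a ⋁ b) ⋁ c) (here refl) = rotate
∈-rotations⁻ ((a ⋁ b) ⋁ c) (there i) with ∈-++⁻ (map (_⋁ c) (rotations (a ⋁ b))) i
... | inj₁ j with _ , k , refl ← ∈-map⁻ (_⋁ c) j         = left (∈-rotations⁻ (a ⋁ b) k)
... | inj₂ j with _ , k , refl ← ∈-map⁻ ((a ⋁ b) ⋁_) j   = right (∈-rotations⁻ c k)

⟶-size : ∀ {s t} → s ⟶ t → size s ≡ size t
⟶-size (rotate {a} {b} {c}) = cong suc
  (trans (cong suc (ℕ.+-assoc (size a) (size b) (size c))) (sym (ℕ.+-suc (size a) (size b ℕ.+ size c))))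
⟶-size (left p)  = cong (λ m → suc (m ℕ.+ _)) (⟶-size p)
⟶-size (right {a} p) = cong (λ m → suc (size a ℕ.+ m)) (⟶-size p)

≼-size : ∀ {s t} → s ≼ t → size s ≡ size t
≼-size ε       = refl
≼-size (p ◅ q) = trans (⟶-size p) (≼-size q)

-- Counts the pairs of a node and one of its left descendants. Rotating `(a ⋁ b) ⋁ c` takes `a` and
-- its parent away from the left of the upper node, so it loses `1 + size a` pairs.
weight : BT → ℕ
weight leaf    = 0
weight (l ⋁ r) = size l ℕ.+ (weight l ℕ.+ weight r)

⟶-weight : ∀ {s t} → s ⟶ t → weight t < weight s
⟶-weight (rotate {a} {b} {c}) = s≤s (begin
  size a ℕ.+ (weight a ℕ.+ (size b ℕ.+ (weight b ℕ.+ weight c)))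
    ≡⟨ cong (size a ℕ.+_) (trans (cong (weight a ℕ.+_) (sym (ℕ.+-assoc (size b) _ _))) (sym (ℕ.+-assoc (weight a) _ _))) ⟩
  size a ℕ.+ ((weight a ℕ.+ (size b ℕ.+ weight b)) ℕ.+ weight c)
    ≡⟨ cong (λ m → size a ℕ.+ (m ℕ.+ weight c)) (x+[y+z]≡y+[x+z] (weight a) (size b) (weight b)) ⟩
  size a ℕ.+ ((size b ℕ.+ (weight a ℕ.+ weight b)) ℕ.+ weight c)
    ≡⟨ trans (cong (size a ℕ.+_) (ℕ.+-assoc (size b) _ _)) (sym (ℕ.+-assoc (size a) _ _)) ⟩
  (size a ℕ.+ size b) ℕ.+ ((weight a ℕ.+ weight b) ℕ.+ weight c)
    ≤⟨ ℕ.+-monoʳ-≤ (size a ℕ.+ size b) (ℕ.+-monoˡ-≤ (weight c) (ℕ.m≤n+m _ (size a))) ⟩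
  (size a ℕ.+ size b) ℕ.+ ((size a ℕ.+ (weight a ℕ.+ weight b)) ℕ.+ weight c) ∎)
  where
  open ℕ.≤-Reasoning
  x+[y+z]≡y+[x+z] : ∀ x y z → x ℕ.+ (y ℕ.+ z) ≡ y ℕ.+ (x ℕ.+ z)
  x+[y+z]≡y+[x+z] x y z =
    trans (sym (ℕ.+-assoc x y z)) (trans (cong (ℕ._+ z) (ℕ.+-comm x y)) (ℕ.+-assoc y x z))
⟶-weight (left {a} {a′} {c} p) rewrite ⟶-size p =
  ℕ.+-monoʳ-< (size a′) (ℕ.+-monoˡ-< (weight c) (⟶-weight p))
⟶-weight (right {a} p) = ℕ.+-monoʳ-< (size a) (ℕ.+-monoʳ-< (weight a) (⟶-weight p))

≼-weight : ∀ {s t} → s ≼ t → s ≡ t ⊎ weight t < weight s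
≼-weight ε = inj₁ refl
≼-weight (p ◅ q) with ≼-weight q
... | inj₁ refl = inj₂ (⟶-weight p)
... | inj₂ lt   = inj₂ (<-trans lt (⟶-weight p))

≼-antisym : ∀ {s t} → s ≼ t → t ≼ s → s ≡ t
≼-antisym p q with ≼-weight p | ≼-weight q
... | inj₁ eq | _       = eq
... | inj₂ _  | inj₁ eq = sym eq
... | inj₂ lt | inj₂ gt = contradiction gt (ℕ.<-asym lt)

eqBT-sound : ∀ s t → T (eqBT s t) → s ≡ t
eqBT-sound leaf leaf _ = refl
eqBT-sound (a ⋁ b) (c ⋁ d) p with q , r ← to T-∧ p = cong₂ _⋁_ (eqBT-sound a c q) (eqBT-sound b d r)

eqBT-refl : ∀ t → T (eqBT t t)
eqBT-refl leaf    = tt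
eqBT-refl (a ⋁ b) = from T-∧ (eqBT-refl a , eqBT-refl b)

_≟BT_ : (s t : BT) → Dec (s ≡ t)
s ≟BT t with eqBT s t in eq
... | true  = yes (eqBT-sound s t (from T-≡ eq))
... | false = no λ { refl → case trans (sym eq) (to T-≡ (eqBT-refl s)) of λ () }

-- Enumeration of trees, and the fuel of the order relation

concatMap-unique : ∀ {A B : Set} {f : A → List B} {xs} → Unique xs → (∀ x → x ∈ xs → Unique (f x)) →
  (∀ x y {z} → x ∈ xs → y ∈ xs → z ∈ f x → z ∈ f y → x ≡ y) → Unique (concatMap f xs)
concatMap-unique {xs = []} _ _ _ = []
concatMap-unique {f = f} {x ∷ xs} (x∉ ∷ u) uf inj = Unique.++⁺ (uf x (here refl))
  (concatMap-unique u (λ y → uf y ∘ there) (λ y z i j → inj y z (there i) (there j)))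
  (λ (i , j) → disjoint i (find (∈-concatMap⁻ f {xs = xs} j)))
  where
  disjoint : ∀ {z} → z ∈ f x → ¬ (∃ λ y → y ∈ xs × z ∈ f y)
  disjoint i (y , y∈ , k) = All.lookup x∉ y∈ (inj x y (here refl) (there y∈) i k)

graftings : ℕ → BT → BT → List BT
graftings n l r = if (size l ℕ.+ size r) ≤ᵇ n then (l ⋁ r) ∷ [] else []

∈-graftings⁻ : ∀ n l r {t} → t ∈ graftings n l r → t ≡ l ⋁ r
∈-graftings⁻ n l r i with (size l ℕ.+ size r) ≤ᵇ n
∈-graftings⁻ n l r (here refl) | true = refl

∈-upToTrees : ∀ n t → size t ≤ n → t ∈ upToTrees n
∈-upToTrees zero    leaf    _       = here refl
∈-upToTrees (suc n) leaf    _       = here refl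
∈-upToTrees (suc n) (l ⋁ r) (s≤s p) = there (∈-concatMap⁺ (λ l → concatMap (graftings n l) (upToTrees n))
  (lose (∈-upToTrees n l (ℕ.m+n≤o⇒m≤o _ p))
    (∈-concatMap⁺ (graftings n l) (lose (∈-upToTrees n r (ℕ.m+n≤o⇒n≤o (size l) p)) small))))
  where
  small : l ⋁ r ∈ graftings n l r
  small rewrite to T-≡ (ℕ.≤⇒≤ᵇ p) = here refl

upToTrees-unique : ∀ n → Unique (upToTrees n)
upToTrees-unique zero    = [] ∷ []
upToTrees-unique (suc n) = All.tabulate nonleaf ∷
  concatMap-unique (upToTrees-unique n)
    (λ l _ → concatMap-unique (upToTrees-unique n) (λ r _ → unique l r)
      (λ r r′ _ _ i j → case trans (sym (∈-graftings⁻ n l r i)) (∈-graftings⁻ n l r′ j) of λ { refl → refl }))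
    (λ l l′ _ _ i j → case (inner l i , inner l′ j) of λ { ((_ , refl) , (_ , refl)) → refl })
  where
  inner : ∀ l {t} → t ∈ concatMap (graftings n l) (upToTrees n) → ∃ λ r → t ≡ l ⋁ r
  inner l i with r , _ , j ← find (∈-concatMap⁻ (graftings n l) {xs = upToTrees n} i) = r , ∈-graftings⁻ n l r j
  nonleaf : ∀ {t} → t ∈ concatMap (λ l → concatMap (graftings n l) (upToTrees n)) (upToTrees n) → leaf ≢ t
  nonleaf i refl with l , _ , j ← find (∈-concatMap⁻ (λ l → concatMap (graftings n l) (upToTrees n)) {xs = upToTrees n} i)
    with () ← proj₂ (inner l j)
  unique : ∀ l r → Unique (graftings n l r)
  unique l r with (size l ℕ.+ size r) ≤ᵇ n
  ... | true  = [] ∷ []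
  ... | false = []

𝒴-unique : ∀ n → Unique (𝒴 n)
𝒴-unique n = Unique.filter⁺ _ (upToTrees-unique n)

∈-𝒴 : ∀ t → t ∈ 𝒴 (size t)
∈-𝒴 t = ∈-filter⁺ _ (∈-upToTrees (size t) t ≤-refl) refl

∈-𝒴-size : ∀ {n t} → t ∈ 𝒴 n → size t ≡ n
∈-𝒴-size {n} i = proj₂ (∈-filter⁻ _ {xs = upToTrees n} i)

size⇒∈-𝒴 : ∀ {n t} → size t ≡ n → t ∈ 𝒴 n
size⇒∈-𝒴 refl = ∈-𝒴 _

module _ {A : Set} {P Q : A → Set} (P? : ∀ x → Dec (P x)) (Q? : ∀ x → Dec (Q x)) (P⊆Q : ∀ {x} → P x → Q x) where

  length-filter-mono : ∀ xs → length (filter P? xs) ≤ length (filter Q? xs)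
  length-filter-mono []       = z≤n
  length-filter-mono (x ∷ xs) with P? x | Q? x
  ... | yes _ | yes _  = s≤s (length-filter-mono xs)
  ... | yes p | no  ¬q = contradiction (P⊆Q p) ¬q
  ... | no  _ | yes _  = ℕ.m≤n⇒m≤1+n (length-filter-mono xs)
  ... | no  _ | no  _  = length-filter-mono xs

  length-filter-strict : ∀ {x xs} → x ∈ xs → ¬ P x → Q x → length (filter P? xs) < length (filter Q? xs)
  length-filter-strict {xs = x ∷ xs} (here refl) ¬p q with P? x | Q? x
  ... | yes p | _     = contradiction p ¬p
  ... | no  _ | yes _ = s≤s (length-filter-mono xs)
  ... | no  _ | no ¬q = contradiction q ¬q
  length-filter-strict {xs = y ∷ xs} (there i) ¬p q with P? y | Q? y
  ... | yes _ | yes _  = s≤s (length-filter-strict i ¬p q)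
  ... | yes p | no  ¬q = contradiction (P⊆Q p) ¬q
  ... | no  _ | yes _  = ℕ.m<n⇒m<1+n (length-filter-strict i ¬p q)
  ... | no  _ | no  _  = length-filter-strict i ¬p q

-- The weight decreases along rotations, so these counts bound the length of
-- chains starting, respectively ending, at a tree.
upRank downRank : ℕ → BT → ℕ
upRank   n s = length (filter (λ v → weight v ℕ.<? weight s) (𝒴 n))
downRank n s = length (filter (λ v → weight s ℕ.<? weight v) (𝒴 n))

upRank-< : ∀ {n s t} → t ∈ 𝒴 n → weight t < weight s → upRank n t < upRank n s
upRank-< t∈ lt = length-filter-strict _ _ (λ p → <-trans p lt) t∈ (<-irrefl refl) lt

downRank-< : ∀ {n s t} → s ∈ 𝒴 n → weight t < weight s → downRank n s < downRank n t
downRank-< s∈ lt = length-filter-strict _ _ (<-trans lt) s∈ (<-irrefl refl) lt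

reach-refl : ∀ k s → s ∈ reach k s
reach-refl zero    s = here refl
reach-refl (suc k) s = here refl

-- No path has to be shortened: each rotation lowers the weight, so `upRank` drops at every step and
-- its value at the start bounds the length.
reach-complete : ∀ {n} k {s t} → size s ≡ n → upRank n s ≤ k → s ≼ t → t ∈ reach k s
reach-complete k _ _ ε = reach-refl k _
reach-complete {n} k {s} sz le (p ◅ q)
  with lt ← upRank-< {n} {s} (size⇒∈-𝒴 (trans (sym (⟶-size p)) sz)) (⟶-weight p)
  with k | ≤-trans lt le
... | suc k | s≤s le′ = there (∈-concatMap⁺ (reach k) (lose (∈-rotations⁺ p)
  (reach-complete k (trans (sym (⟶-size p)) sz) le′ q)))

reach-sound : ∀ k {s t} → t ∈ reach k s → s ≼ t
reach-sound zero    (here refl) = ε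
reach-sound (suc k) (here refl) = ε
reach-sound (suc k) {s} (there i) with u , u∈ , j ← find (∈-concatMap⁻ (reach k) {xs = rotations s} i) =
  ∈-rotations⁻ s u∈ ◅ reach-sound k j

≤T⇔≼ : ∀ {s t} → T (s ≤T t) ⇔ s ≼ t
≤T⇔≼ {s} {t} = mk⇔
  (λ p → let u , u∈ , eq = find (Any.any⁻ (eqBT t) (reach (length (𝒴 (size s))) s) p)
         in subst (s ≼_) (sym (eqBT-sound t u eq)) (reach-sound _ u∈))
  (λ p → Any.any⁺ (eqBT t) (lose (reach-complete _ refl (length-filter _ (𝒴 (size s))) p) (eqBT-refl t)))

-- Labellings compatible with a tree

-- Fits t ω: labelling the nodes of t in infix order by ω, every node exceeds
-- its left descendants.  Equivalently ω lies below γ(t) in the weak order.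
data Fits : BT → List ℕ → Set where
  leaf : Fits leaf []
  node : ∀ {l r ω} a x b → ω ≡ a ++ x ∷ b → Fits l a → All (_< x) a → Fits r b → Fits (l ⋁ r) ω

Fits-length : ∀ {t ω} → Fits t ω → length ω ≡ size t
Fits-length leaf = refl
Fits-length (node a x b refl p _ q) = trans (length-++ a)
  (trans (ℕ.+-suc (length a) (length b)) (cong suc (cong₂ ℕ._+_ (Fits-length p) (Fits-length q))))

++-injective : ∀ {A : Set} (a a′ : List A) {b b′} → length a ≡ length a′ → a ++ b ≡ a′ ++ b′ → a ≡ a′ × b ≡ b′
++-injective []      []        _ eq = refl , eq
++-injective (x ∷ a) (y ∷ a′) le eq with refl , eq′ ← ∷-injective eq
  with refl , refl ← ++-injective a a′ (suc-injective le) eq′ = refl , refl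

-- The cut stored in `node` is forced, since its left part has `size l` letters.
Fits-node⁻ : ∀ {l r} a {x b} → length a ≡ size l → Fits (l ⋁ r) (a ++ x ∷ b) → Fits l a × All (_< x) a × Fits r b
Fits-node⁻ a le (node a′ x′ b′ eq p lt q)
  with refl , refl ← ++-injective a a′ (trans le (sym (Fits-length p))) eq = p , lt , q

++-split : ∀ {A : Set} m {k} {ω : List A} → length ω ≡ m ℕ.+ k →
  ∃₂ λ a b → ω ≡ a ++ b × length a ≡ m × length b ≡ k
++-split zero    {ω = ω}     le = [] , ω , refl , refl , le
++-split (suc m) {ω = x ∷ ω} le with a , b , refl , la , lb ← ++-split m {ω = ω} (suc-injective le) =
  x ∷ a , b , refl , cong suc la , lb

node-split : ∀ {A : Set} l r {ω : List A} → length ω ≡ size (l ⋁ r) →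
  ∃₂ λ a x → ∃ λ b → ω ≡ a ++ x ∷ b × length a ≡ size l × length b ≡ size r
node-split l r le with ++-split (size l) (trans le (sym (ℕ.+-suc (size l) (size r))))
... | a , x ∷ b , eq , la , lb = a , x , b , eq , la , suc-injective lb

-- `Fits` only asks certain labels to be smaller than others, so it passes from `f` to `g` as soon
-- as every strict inequality between letters of `ω` does. This covers `st` and shifts in both
-- directions.
Fits-transport : ∀ {A : Set} (f g : A → ℕ) {t} ω → (∀ {x y} → x ∈ ω → y ∈ ω → f x < f y → g x < g y) →
  Fits t (map f ω) → Fits t (map g ω)
Fits-transport f g [] h leaf = leaf
Fits-transport f g {l ⋁ r} ω h p
  with a , x , b , refl , la , lb ← node-split l r {ω} (trans (sym (length-map f ω)) (Fits-length p))
  with pa , lt , pb ← Fits-node⁻ (map f a) (trans (length-map f a) la) (subst (Fits (l ⋁ r)) (map-++ f a (x ∷ b)) p) =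
  node (map g a) (g x) (map g b) (map-++ g a (x ∷ b))
    (Fits-transport f g a (λ i j → h (∈-++⁺ˡ i) (∈-++⁺ˡ j)) pa)
    (All.map⁺ (All.tabulate λ i → h (∈-++⁺ˡ i) (∈-insert a) (All.lookup (All.map⁻ lt) i)))
    (Fits-transport f g b (λ i j → h (∈-++⁺ʳ a (there i)) (∈-++⁺ʳ a (there j))) pb)

-- A rotation only takes left descendants away: in `rotate` the node labelled `y` keeps `b` on its
-- left and loses `a` and `x`. Conditions are dropped, never added.
Fits-mono : ∀ {s t ω} → s ≼ t → Fits s ω → Fits t ω
Fits-mono ε p = p
Fits-mono (s⟶u ◅ u≼t) p = Fits-mono u≼t (step s⟶u p)
  where
  step : ∀ {s t ω} → s ⟶ t → Fits s ω → Fits t ω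
  step rotate (node _ y c refl (node a x b refl pa a<x pb) ab<y pc) =
    node a x (b ++ y ∷ c) (++-assoc a (x ∷ b) (y ∷ c)) pa a<x
      (node b y c refl pb (All.tail (All.++⁻ʳ a ab<y)) pc)
  step (left r)  (node a x b eq pa lt pb) = node a x b eq (step r pa) lt pb
  step (right r) (node a x b eq pa lt pb) = node a x b eq pa lt (step r pb)

-- Compares two cuts of one word; `before` and `after` say where `y` lies relative to `x`. The case
-- `after` records only a membership, by which each use refutes it.
data Position {A : Set} (a : List A) (x : A) (b c : List A) (y : A) (d : List A) : Set where
  same   : a ≡ c → x ≡ y → b ≡ d → Position a x b c y d
  before : ∀ e → a ≡ c ++ y ∷ e → d ≡ e ++ x ∷ b → Position a x b c y d
  after  : x ∈ c → Position a x b c y d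

position : ∀ {A : Set} (a : List A) {x b} c {y d} → a ++ x ∷ b ≡ c ++ y ∷ d → Position a x b c y d
position []      []      refl = same refl refl refl
position []      (_ ∷ c) refl = after (here refl)
position (_ ∷ a) []      refl = before a refl refl
position (z ∷ a) (_ ∷ c) eq with refl , eq′ ← ∷-injective eq with position a c eq′
... | same refl refl refl   = same refl refl refl
... | before e refl refl    = before e refl refl
... | after i               = after (there i)

-- If m is the maximal label, rotating its node up to the root of t goes down in the order.
Fits-split-max : ∀ {t ω} b m a → ω ≡ b ++ m ∷ a → All (_≤ m) ω → Fits t ω →
  ∃₂ λ u v → Fits u b × Fits v a × u ⋁ v ≼ t
Fits-split-max []      m a () _ leaf
Fits-split-max (_ ∷ _) m a () _ leaf
Fits-split-max b m a eq le (node {l} c y d refl p c<y q) with position b c (sym eq)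
... | same refl refl refl = _ , _ , p , q , ε
... | after i = contradiction (<-≤-trans (All.lookup c<y i) (All.lookup le (∈-insert c))) (<-irrefl refl)
... | before e b≡ d≡ with u , v , pu , pv , uv≼r ← Fits-split-max e m a d≡ (All.tail (All.++⁻ʳ c le)) q =
  l ⋁ u , v , node c y e b≡ p c<y pu , pv , rotate ◅ ⋁-mono-≼ ε uv≼r

-- λ as the least compatible tree

countLess-mono : ∀ {x y} zs → x ≤ y → countLess x zs ≤ countLess y zs
countLess-mono [] _ = z≤n
countLess-mono {x} {y} (z ∷ zs) le with z <ᵇ x in eqx | z <ᵇ y in eqy
... | true  | true  = s≤s (countLess-mono zs le)
... | true  | false = case subst T eqy (ℕ.<⇒<ᵇ (<-≤-trans (ℕ.<ᵇ⇒< z x (from T-≡ eqx)) le)) of λ ()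
... | false | true  = ℕ.m≤n⇒m≤1+n (countLess-mono zs le)
... | false | false = countLess-mono zs le

-- The letter `x` itself is counted for `y` but not for `x`.
countLess-strict : ∀ {x y zs} → x ∈ zs → x < y → countLess x zs < countLess y zs
countLess-strict {x} {y} {z ∷ zs} (here refl) lt with z <ᵇ x in eqx | z <ᵇ y in eqy
... | true  | _     = contradiction (ℕ.<ᵇ⇒< z z (from T-≡ eqx)) (<-irrefl refl)
... | false | true  = s≤s (countLess-mono zs (<⇒≤ lt))
... | false | false = case subst T eqy (ℕ.<⇒<ᵇ lt) of λ ()
countLess-strict {x} {y} {z ∷ zs} (there i) lt with z <ᵇ x in eqx | z <ᵇ y in eqy
... | true  | true  = s≤s (countLess-strict i lt)
... | true  | false = case subst T eqy (ℕ.<⇒<ᵇ (<-trans (ℕ.<ᵇ⇒< z x (from T-≡ eqx)) lt)) of λ ()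
... | false | true  = ℕ.m<n⇒m<1+n (countLess-strict i lt)
... | false | false = countLess-strict i lt

Fits-st⁺ : ∀ {t ω} → Fits t ω → Fits t (st ω)
Fits-st⁺ {t} {ω} p = Fits-transport id _ ω (λ i _ lt → s≤s (countLess-strict i lt)) (subst (Fits t) (sym (map-id ω)) p)

Fits-st⁻ : ∀ {t ω} → Fits t (st ω) → Fits t ω
Fits-st⁻ {t} {ω} p = subst (Fits t) (map-id ω) (Fits-transport (λ x → suc (countLess x ω)) id ω reflect p)
  where
  reflect : ∀ {x y} → x ∈ ω → y ∈ ω → suc (countLess x ω) < suc (countLess y ω) → x < y
  reflect {x} {y} _ _ (s≤s lt) = ℕ.≰⇒> λ y≤x → contradiction (≤-trans lt (countLess-mono ω y≤x)) (<-irrefl refl)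

≤-maxL : ∀ ω → All (_≤ maxL ω) ω
≤-maxL []      = []
≤-maxL (x ∷ ω) = ℕ.m≤m⊔n x (maxL ω) ∷ All.map (λ le → ≤-trans le (ℕ.m≤n⊔m x (maxL ω))) (≤-maxL ω)

maxL∈ : ∀ x ω → maxL (x ∷ ω) ∈ x ∷ ω
maxL∈ x [] rewrite ℕ.⊔-identityʳ x = here refl
maxL∈ x (y ∷ ω) with ℕ.⊔-sel x (maxL (y ∷ ω))
... | inj₁ eq = here eq
... | inj₂ eq = there (subst (_∈ y ∷ ω) (sym eq) (maxL∈ y ω))

-- `splitAt` cuts at the first occurrence, so no earlier letter equals `m`. This gives the strict
-- bound that a `Fits` node requires, even for a word with repetitions.
splitAt-max : ∀ {m ω b a} → m ∈ ω → All (_≤ m) ω → splitAt m ω ≡ b ,, a → ω ≡ b ++ m ∷ a × All (_< m) b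
splitAt-max {m} {x ∷ ω} i (x≤m ∷ le) eq with x ≡ᵇ m in xm
splitAt-max {m} {x ∷ ω} i (x≤m ∷ le) refl | true = cong (_∷ ω) (ℕ.≡ᵇ⇒≡ x m (from T-≡ xm)) , []
splitAt-max {m} {x ∷ ω} i (x≤m ∷ le) eq | false with splitAt m ω in sp
splitAt-max {m} {x ∷ ω} (here refl) (x≤m ∷ le) refl | false | b ,, a = case subst T xm (ℕ.≡⇒≡ᵇ x x refl) of λ ()
splitAt-max {m} {x ∷ ω} (there i) (x≤m ∷ le) refl | false | b ,, a with ω≡ , lt ← splitAt-max i le sp =
  cong (x ∷_) ω≡ , ℕ.≤∧≢⇒< x≤m (λ x≡m → case subst T xm (ℕ.≡⇒≡ᵇ x m x≡m) of λ ()) ∷ lt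

private
  length-parts : ∀ {k} {ω : List ℕ} b {m a} → ω ≡ b ++ m ∷ a → length ω ≤ suc k →
    length (st b) ≤ k × length (st a) ≤ k
  length-parts {k} b {m} {a} refl le =
    subst (_≤ k) (sym (length-map _ b)) (ℕ.m+n≤o⇒m≤o (length b) sum≤) ,
    subst (_≤ k) (sym (length-map _ a)) (ℕ.m+n≤o⇒n≤o (length b) sum≤)
    where
    sum≤ : length b ℕ.+ length a ≤ k
    sum≤ = ℕ.≤-pred (subst (_≤ suc k) (trans (length-++ b) (ℕ.+-suc (length b) (length a))) le)

lamF-fits : ∀ k {ω} → length ω ≤ k → Fits (lamF k ω) ω
lamF-fits zero    {[]}    _  = leaf
lamF-fits (suc k) {[]}    _  = leaf
lamF-fits (suc k) {x ∷ ω} le with splitAt (maxL (x ∷ ω)) (x ∷ ω) in sp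
... | b ,, a with eq , lt ← splitAt-max (maxL∈ x ω) (≤-maxL (x ∷ ω)) sp
  with lb , la ← length-parts b eq le =
  node b _ a eq (Fits-st⁻ (lamF-fits k lb)) lt (Fits-st⁻ (lamF-fits k la))

-- λ puts the maximal label at the root. `Fits-split-max` finds below any compatible `t` a tree with
-- the same root, whose subtrees are compatible with the two halves, and the recursion compares
-- these.
lamF-least : ∀ k {t ω} → length ω ≤ k → Fits t ω → lamF k ω ≼ t
lamF-least zero    {ω = []} _ leaf = ε
lamF-least (suc k) {ω = []} _ leaf = ε
lamF-least zero    {ω = []} _ (node []      _ _ () _ _ _)
lamF-least zero    {ω = []} _ (node (_ ∷ _) _ _ () _ _ _)
lamF-least (suc k) {ω = []} _ (node []      _ _ () _ _ _)
lamF-least (suc k) {ω = []} _ (node (_ ∷ _) _ _ () _ _ _)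
lamF-least (suc k) {ω = x ∷ ω} le p with splitAt (maxL (x ∷ ω)) (x ∷ ω) in sp
... | b ,, a with eq , lt ← splitAt-max (maxL∈ x ω) (≤-maxL (x ∷ ω)) sp
  with lb , la ← length-parts b eq le
  with u , v , pu , pv , uv≼t ← Fits-split-max b _ a eq (≤-maxL (x ∷ ω)) p =
  ⋁-mono-≼ (lamF-least k lb (Fits-st⁺ pu)) (lamF-least k la (Fits-st⁺ pv)) ◅◅ uv≼t

-- The trees compatible with ω form an up-set, and λ(ω) is its least element.
lam-≼⇔Fits : ∀ {ω t} → lam ω ≼ t ⇔ Fits t ω
lam-≼⇔Fits = mk⇔ (λ le → Fits-mono le (lamF-fits _ ≤-refl)) (lamF-least _ ≤-refl)

size-lam : ∀ ω → size (lam ω) ≡ length ω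
size-lam ω = sym (Fits-length (lamF-fits (length ω) ≤-refl))

-- γ as the greatest compatible labelling

-- Tight t ω: ω is order isomorphic to γ(t).
data Tight : BT → List ℕ → Set where
  leaf : Tight leaf []
  node : ∀ {l r ω} a x b → ω ≡ a ++ x ∷ b → Tight l a → All (_< x) a → All (_< x) b →
         All (λ y → All (_< y) b) a → Tight r b → Tight (l ⋁ r) ω

Tight⇒Fits : ∀ {t ω} → Tight t ω → Fits t ω
Tight⇒Fits leaf = leaf
Tight⇒Fits (node a x b eq p a<x _ _ q) = node a x b eq (Tight⇒Fits p) a<x (Tight⇒Fits q)

-- The root label of a tight word is its maximum, so any compatible `t` can be cut there by
-- `Fits-split-max`, and the halves are tight again.
Tight-greatest : ∀ {s t ω} → Tight s ω → Fits t ω → s ≼ t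
Tight-greatest leaf leaf = ε
Tight-greatest leaf (node []      _ _ () _ _ _)
Tight-greatest leaf (node (_ ∷ _) _ _ () _ _ _)
Tight-greatest (node a x b refl p a<x b<x _ q) f
  with u , v , fu , fv , uv≼t ← Fits-split-max a x b refl (All.++⁺ (All.map <⇒≤ a<x) (≤-refl ∷ All.map <⇒≤ b<x)) f =
  ⋁-mono-≼ (Tight-greatest p fu) (Tight-greatest q fv) ◅◅ uv≼t

Tight-map : ∀ {f : ℕ → ℕ} {t ω} → (∀ {x y} → x < y → f x < f y) → Tight t ω → Tight t (map f ω)
Tight-map h leaf = leaf
Tight-map {f} h (node a x b refl p a<x b<x b<a q) =
  node (map f a) (f x) (map f b) (map-++ f a (x ∷ b)) (Tight-map h p) (All.map⁺ (All.map h a<x))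
    (All.map⁺ (All.map h b<x)) (All.map⁺ (All.map (All.map⁺ ∘ All.map h) b<a)) (Tight-map h q)

length-gam : ∀ t → length (gam t) ≡ size t
length-gam leaf    = refl
length-gam (l ⋁ r) = trans (length-++ (map _ (gam l)))
  (trans (cong₂ (λ m k → m ℕ.+ suc k) (trans (length-map _ (gam l)) (length-gam l)) (length-gam r))
         (ℕ.+-suc (size l) (size r)))

gam-positive : ∀ t → All (0 <_) (gam t)
gam-positive leaf    = []
gam-positive (l ⋁ r) =
  All.++⁺ (All.map⁺ (All.map (λ {x} p → <-≤-trans p (ℕ.m≤m+n x _)) (gam-positive l))) (s≤s z≤n ∷ gam-positive r)

gam-bounded : ∀ t → All (_≤ size t) (gam t)
gam-bounded leaf    = []
gam-bounded (l ⋁ r) rewrite length-gam l | length-gam r = All.++⁺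
  (All.map⁺ (All.map (λ p → ℕ.m≤n⇒m≤1+n (ℕ.+-monoˡ-≤ (size r) p)) (gam-bounded l)))
  (≤-refl ∷ All.map (λ p → ℕ.m≤n⇒m≤1+n (≤-trans p (ℕ.m≤n+m (size r) (size l)))) (gam-bounded r))

gam-tight : ∀ t → Tight t (gam t)
gam-tight leaf    = leaf
gam-tight (l ⋁ r) = node _ _ _ refl
  (Tight-map (ℕ.+-monoˡ-< _) (gam-tight l))
  (All.map⁺ (All.map (λ p → s≤s (ℕ.+-monoˡ-≤ _ (subst (_ ≤_) (sym (length-gam l)) p))) (gam-bounded l)))
  (All.map (λ p → s≤s (≤-trans p (ℕ.m≤n+m _ (length (gam l))))) r≤)
  (All.map⁺ (All.map (λ {z} 0<z → All.map (λ p → ≤-<-trans p (ℕ.+-monoˡ-< (length (gam r)) 0<z)) r≤) (gam-positive l)))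
  (gam-tight r)
  where
  r≤ : All (_≤ length (gam r)) (gam r)
  r≤ = subst (λ m → All (_≤ m) (gam r)) (sym (length-gam r)) (gam-bounded r)

-- Turns a comparison with `s` on the left into a condition on the labels γ(s); together with
-- `lam-≼⇔Fits` it brings both sides of the product rule into terms of labels.
Fits-gam⇔≼ : ∀ {s t} → Fits t (gam s) ⇔ s ≼ t
Fits-gam⇔≼ {s} = mk⇔ (Tight-greatest (gam-tight s)) (λ le → Fits-mono le (Tight⇒Fits (gam-tight s)))

-- Restriction of trees

-- A subset of the nodes carried along the shape of the tree, so that restriction and admissibility
-- can recurse on it; `marks` reads it in infix order as a characteristic list.
data Marking : BT → Set where
  leaf : Marking leaf
  node : ∀ {l r} → Marking l → Bool → Marking r → Marking (l ⋁ r)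

marks : ∀ {t} → Marking t → List Bool
marks leaf         = []
marks (node m β k) = marks m ++ β ∷ marks k

co : ∀ {t} → Marking t → Marking t
co leaf         = leaf
co (node m β k) = node (co m) (not β) (co k)

marks-co : ∀ {t} (m : Marking t) → marks (co m) ≡ complement (marks m)
marks-co leaf         = refl
marks-co (node m β k) = trans (cong₂ (λ xs ys → xs ++ not β ∷ ys) (marks-co m) (marks-co k))
                              (sym (map-++ not (marks m) (β ∷ marks k)))

length-marks : ∀ {t} (m : Marking t) → length (marks m) ≡ size t
length-marks leaf         = refl
length-marks (node m β k) = trans (length-++ (marks m))
  (trans (ℕ.+-suc _ _) (cong suc (cong₂ ℕ._+_ (length-marks m) (length-marks k))))

marks-surjective : ∀ t {R} → length R ≡ size t → ∃ λ (m : Marking t) → marks m ≡ R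
marks-surjective leaf    {[]} _  = leaf , refl
marks-surjective (l ⋁ r) {R}  le with a , β , b , refl , la , lb ← node-split l r {R} le
  with m , refl ← marks-surjective l {a} la | k , refl ← marks-surjective r {b} lb = node m β k , refl

-- Replaces the rightmost leaf of the first tree by the second, the "under" operation on binary
-- trees.
graft : BT → BT → BT
graft leaf    u = u
graft (a ⋁ b) u = a ⋁ graft b u

-- t|_R by recursion on t: deleting the root leaves t_r grafted at the right end of t_l.
restrict : ∀ {t} → Marking t → BT
restrict leaf             = leaf
restrict (node m true  k) = restrict m ⋁ restrict k
restrict (node m false k) = graft (restrict m) (restrict k)

select-++ : ∀ {A B : List _} {xs ys} → length A ≡ length xs → select (A ++ B) (xs ++ ys) ≡ select A xs ++ select B ys
select-++ {[]}        {xs = []}     _  = refl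
select-++ {true ∷ A}  {xs = x ∷ xs} le = cong (x ∷_) (select-++ {A} (suc-injective le))
select-++ {false ∷ A} {xs = x ∷ xs} le = select-++ {A} (suc-injective le)

select-node : ∀ {l r} (m : Marking l) β (k : Marking r) {a x b} → length a ≡ size l →
  select (marks (node m β k)) (a ++ x ∷ b) ≡ select (marks m) a ++ select (β ∷ marks k) (x ∷ b)
select-node m β k la = select-++ {marks m} (trans (length-marks m) (sym la))

select-All : ∀ {P : ℕ → Set} {ω} R → All P ω → All P (select R ω)
select-All []          _        = []
select-All (true  ∷ R) []       = []
select-All (false ∷ R) []       = []
select-All (true  ∷ R) (p ∷ ps) = p ∷ select-All R ps
select-All (false ∷ R) (p ∷ ps) = select-All R ps

length-select : ∀ R {ω} → length R ≡ length ω → length (select R ω) ≡ countTrue R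
length-select []          {[]}    _  = refl
length-select (true  ∷ R) {x ∷ ω} le = cong suc (length-select R (suc-injective le))
length-select (false ∷ R) {x ∷ ω} le = length-select R (suc-injective le)

size-graft : ∀ s t → size (graft s t) ≡ size s ℕ.+ size t
size-graft leaf    t = refl
size-graft (a ⋁ b) t = cong suc (trans (cong (size a ℕ.+_) (size-graft b t)) (sym (ℕ.+-assoc (size a) _ _)))

countTrue-++ : ∀ A B → countTrue (A ++ B) ≡ countTrue A ℕ.+ countTrue B
countTrue-++ []          B = refl
countTrue-++ (true  ∷ A) B = cong suc (countTrue-++ A B)
countTrue-++ (false ∷ A) B = countTrue-++ A B

size-restrict : ∀ {t} (m : Marking t) → size (restrict m) ≡ countTrue (marks m)
size-restrict leaf = refl
size-restrict (node m true k) = sym (trans (countTrue-++ (marks m) _)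
  (trans (ℕ.+-suc _ _) (cong suc (sym (cong₂ ℕ._+_ (size-restrict m) (size-restrict k))))))
size-restrict (node m false k) = trans (size-graft (restrict m) _)
  (trans (cong₂ ℕ._+_ (size-restrict m) (size-restrict k)) (sym (countTrue-++ (marks m) _)))

length-select-marks : ∀ {t} (m : Marking t) {ω} → length ω ≡ size t → length (select (marks m) ω) ≡ size (restrict m)
length-select-marks m le = trans (length-select (marks m) (trans (length-marks m) (sym le))) (sym (size-restrict m))

-- Grafting at the rightmost leaf gives no node a new left descendant, so no label of `a` is
-- compared with one of `b`.
Fits-graft⁺ : ∀ {s t a b} → Fits s a → Fits t b → Fits (graft s t) (a ++ b)
Fits-graft⁺ leaf q = q
Fits-graft⁺ {b = b} (node c x d refl p lt p′) q = node c x (d ++ b) (++-assoc c (x ∷ d) b) p lt (Fits-graft⁺ p′ q)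

Fits-graft⁻ : ∀ s {t} a {b} → length a ≡ size s → Fits (graft s t) (a ++ b) → Fits s a × Fits t b
Fits-graft⁻ leaf [] _ q = leaf , q
Fits-graft⁻ (l ⋁ r) a {b} la q with c , x , d , refl , lc , ld ← node-split l r {a} la
  with p , lt , q′ ← Fits-node⁻ c lc (subst (Fits _) (++-assoc c (x ∷ d) b) q)
  with p′ , q″ ← Fits-graft⁻ r d ld q′ = node c x d refl p lt p′ , q″

Tight-graft : ∀ {s t a b} → Tight s a → Tight t b → All (λ y → All (_< y) b) a → Tight (graft s t) (a ++ b)
Tight-graft leaf q _ = q
Tight-graft {b = b} (node c x d refl p c<x d<x d<c p′) q b<a
  with b<c , (b<x ∷ b<d) ← All.++⁻ c b<a =
  node c x (d ++ b) (++-assoc c (x ∷ d) b) p c<x (All.++⁺ d<x b<x)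
    (All.zipWith (λ (u , v) → All.++⁺ u v) (d<c , b<c)) (Tight-graft p′ q b<d)

-- When the root is deleted, the labels on its left still exceed those on its right, which is the
-- hypothesis of `Tight-graft`.
Tight-restrict : ∀ {t ω} (m : Marking t) → Tight t ω → Tight (restrict m) (select (marks m) ω)
Tight-restrict leaf leaf = leaf
Tight-restrict (node m β k) (node a x b refl p a<x b<x b<a q)
  rewrite select-node m β k {a} {x} {b} (Fits-length (Tight⇒Fits p)) = root β
  where
  selected : All (λ y → All (_< y) (select (marks k) b)) (select (marks m) a)
  selected = select-All (marks m) (All.map (select-All (marks k)) b<a)
  root : ∀ β → Tight (restrict (node m β k)) (select (marks m) a ++ select (β ∷ marks k) (x ∷ b))
  root true  = node _ x _ refl (Tight-restrict m p) (select-All (marks m) a<x) (select-All (marks k) b<x)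
                 selected (Tight-restrict k q)
  root false = Tight-graft (Tight-restrict m p) (Tight-restrict k q) selected

-- Both trees are least among those compatible with the selected word: the first because λ is, the
-- second because the word is tight for it. `st` does not affect compatibility.
restrictT≡restrict : ∀ {t} (m : Marking t) → restrictT t (marks m) ≡ restrict m
restrictT≡restrict {t} m = ≼-antisym
  (from lam-≼⇔Fits (Fits-st⁺ (Tight⇒Fits tight)))
  (Tight-greatest tight (Fits-st⁻ (to lam-≼⇔Fits ε)))
  where
  tight : Tight (restrict m) (select (marks m) (gam t))
  tight = Tight-restrict m (gam-tight t)

-- Compatibility of a labelling in which the marked labels lie below the unmarked ones

-- Admissible m: no marked node has an unmarked left descendant.
Admissible : ∀ {t} → Marking t → Set
Admissible leaf             = ⊤
Admissible (node m true  k) = Admissible m × size (restrict (co m)) ≡ 0 × Admissible k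
Admissible (node m false k) = Admissible m × Admissible k

Separated : ∀ {t} → Marking t → List ℕ → Set
Separated m ω = All (λ x → All (x <_) (select (marks (co m)) ω)) (select (marks m) ω)

Separated-node : ∀ {l r} (m : Marking l) β (k : Marking r) {a x b} → length a ≡ size l →
  Separated (node m β k) (a ++ x ∷ b) → Separated m a × Separated k b ×
  All (λ y → All (y <_) (select (not β ∷ marks (co k)) (x ∷ b))) (select (marks m) a) ×
  All (λ y → All (y <_) (select (marks (co m)) a)) (select (β ∷ marks k) (x ∷ b))
Separated-node m β k {a} {x} {b} la sep
  with p , q ← All.++⁻ (select (marks m) a) (subst₂ (λ u v → All (λ y → All (y <_) v) u)
                 (select-node m β k la) (select-node (co m) (not β) (co k) la) sep) =
  All.map (All.++⁻ˡ a₀) p , separated-tail β (All.map (All.++⁻ʳ a₀) q) ,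
  All.map (All.++⁻ʳ a₀) p , All.map (All.++⁻ˡ a₀) q
  where
  a₀ = select (marks (co m)) a
  separated-tail : ∀ β → All (λ y → All (y <_) (select (not β ∷ marks (co k)) (x ∷ b))) (select (β ∷ marks k) (x ∷ b)) →
    Separated k b
  separated-tail true  (_ ∷ p) = p
  separated-tail false p       = All.map All.tail p

All-select⁻ : ∀ {P : ℕ → Set} R {ω} → length R ≡ length ω → All P (select R ω) → All P (select (complement R) ω) → All P ω
All-select⁻ []          {[]}    _  _        _        = []
All-select⁻ (true  ∷ R) {x ∷ ω} le (p ∷ ps) qs       = p ∷ All-select⁻ R (suc-injective le) ps qs
All-select⁻ (false ∷ R) {x ∷ ω} le ps       (q ∷ qs) = q ∷ All-select⁻ R (suc-injective le) ps qs

All-marks⁻ : ∀ {P : ℕ → Set} {t} (m : Marking t) {ω} → length ω ≡ size t →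
  All P (select (marks m) ω) → All P (select (marks (co m)) ω) → All P ω
All-marks⁻ m le p q = All-select⁻ (marks m) (trans (length-marks m) (sym le)) p
  (subst (λ R → All _ (select R _)) (marks-co m) q)

Fits-restrict : ∀ {t ω} (m : Marking t) → Fits t ω → Fits (restrict m) (select (marks m) ω)
Fits-restrict leaf leaf = leaf
Fits-restrict (node m β k) (node a x b refl p a<x q) rewrite select-node m β k {a} {x} {b} (Fits-length p) = root β
  where
  root : ∀ β → Fits (restrict (node m β k)) (select (marks m) a ++ select (β ∷ marks k) (x ∷ b))
  root true  = node _ x _ refl (Fits-restrict m p) (select-All (marks m) a<x) (Fits-restrict k q)
  root false = Fits-graft⁺ (Fits-restrict m p) (Fits-restrict k q)

-- Under a marked root `x`, an unmarked left descendant would exceed `x` by separation and lie below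
-- `x` by compatibility.
Fits⇒Admissible : ∀ {t ω} (m : Marking t) → Separated m ω → Fits t ω → Admissible m
Fits⇒Admissible leaf _ leaf = tt
Fits⇒Admissible (node m true k) sep (node a x b refl p a<x q)
  with sm , sk , _ , (x<a₀ ∷ _) ← Separated-node m true k {a} (Fits-length p) sep =
  Fits⇒Admissible m sm p ,
  trans (sym (length-select-marks (co m) (Fits-length p))) (empty x<a₀ (select-All (marks (co m)) a<x)) ,
  Fits⇒Admissible k sk q
  where
  empty : ∀ {ω} → All (x <_) ω → All (_< x) ω → length ω ≡ 0
  empty []      _       = refl
  empty (p ∷ _) (q ∷ _) = contradiction q (ℕ.<-asym p)
Fits⇒Admissible (node m false k) sep (node a x b refl p a<x q)
  with sm , sk , _ ← Separated-node m false k {a} (Fits-length p) sep = Fits⇒Admissible m sm p , Fits⇒Admissible k sk q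

-- Every comparison of a root with a left descendant has a source. If the marks agree, it is one of
-- the two restrictions; a marked descendant of an unmarked root is smaller by separation; an
-- unmarked descendant of a marked root is excluded by admissibility.
Admissible⇒Fits : ∀ {t ω} (m : Marking t) → length ω ≡ size t → Separated m ω → Admissible m →
  Fits (restrict m) (select (marks m) ω) → Fits (restrict (co m)) (select (marks (co m)) ω) → Fits t ω
Admissible⇒Fits {ω = []} leaf _ _ _ _ _ = leaf
Admissible⇒Fits {l ⋁ r} {ω} (node m β k) le sep ok f g with a , x , b , refl , la , lb ← node-split l r {ω} le
  with sm , sk , m<x , x<m ← Separated-node m β k {a} la sep
  = root β ok (subst (Fits _) (select-node m β k la) f) (subst (Fits _) (select-node (co m) (not β) (co k) la) g) m<x
  where
  lm  = length-select-marks m la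
  lm′ = length-select-marks (co m) la
  root : ∀ β → Admissible (node m β k) →
    Fits (restrict (node m β k)) (select (marks m) a ++ select (β ∷ marks k) (x ∷ b)) →
    Fits (restrict (co (node m β k))) (select (marks (co m)) a ++ select (not β ∷ marks (co k)) (x ∷ b)) →
    All (λ y → All (y <_) (select (not β ∷ marks (co k)) (x ∷ b))) (select (marks m) a) →
    Fits (l ⋁ r) (a ++ x ∷ b)
  root true (okm , none , okk) f g _
    with fm , lt , fk ← Fits-node⁻ (select (marks m) a) lm f
       | gm , gk ← Fits-graft⁻ (restrict (co m)) (select (marks (co m)) a) lm′ g =
    node a x b refl (Admissible⇒Fits m la sm okm fm gm)
      (All-marks⁻ m la lt (vacuous (trans lm′ none))) (Admissible⇒Fits k lb sk okk fk gk)
    where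
    vacuous : ∀ {ω} → length ω ≡ 0 → All (_< x) ω
    vacuous {[]} _ = []
  root false (okm , okk) f g m<x
    with fm , fk ← Fits-graft⁻ (restrict m) (select (marks m) a) lm f
       | gm , lt , gk ← Fits-node⁻ (select (marks (co m)) a) lm′ g =
    node a x b refl (Admissible⇒Fits m la sm okm fm gm)
      (All-marks⁻ m la (All.map All.head m<x) lt) (Admissible⇒Fits k lb sk okk fk gk)

AllPairs-++⁻ : ∀ xs {ys} → AllPairs _<_ (xs ++ ys) → AllPairs _<_ xs × AllPairs _<_ ys × All (λ x → All (x <_) ys) xs
AllPairs-++⁻ []       s        = [] , s , []
AllPairs-++⁻ (x ∷ xs) (p ∷ s) with sx , sy , lt ← AllPairs-++⁻ xs s =
  All.++⁻ˡ xs p ∷ sx , sy , All.++⁻ʳ xs p ∷ lt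

-- Left descendants precede their ancestor in infix order, so an increasing labelling meets every
-- condition.
Fits-sorted : ∀ t {ω} → length ω ≡ size t → AllPairs _<_ ω → Fits t ω
Fits-sorted leaf    {[]} _  _ = leaf
Fits-sorted (l ⋁ r) {ω}  le s with a , x , b , refl , la , lb ← node-split l r {ω} le
  with sa , (_ ∷ sb) , lt ← AllPairs-++⁻ a s =
  node a x b refl (Fits-sorted l la sa) (All.map All.head lt) (Fits-sorted r lb sb)

-- The labelling by π_R

module _ (p : ℕ) where

  length-piAux : ∀ R i j → length (piAux R p i j) ≡ length R
  length-piAux []          i j = refl
  length-piAux (true  ∷ R) i j = cong suc (length-piAux R (suc i) j)
  length-piAux (false ∷ R) i j = cong suc (length-piAux R i (suc j))

  -- Invariant of the scan: `i` and `j` count the marked and unmarked positions already passed, so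
  -- the marked values still to come start above `i`.
  select-piAux : ∀ R i j → AllPairs _<_ (select R (piAux R p i j)) ×
    All (i <_) (select R (piAux R p i j)) × All (_≤ i ℕ.+ countTrue R) (select R (piAux R p i j))
  select-piAux []          i j = [] , [] , []
  select-piAux (true  ∷ R) i j with s , lo , hi ← select-piAux R (suc i) j rewrite ℕ.+-suc i (countTrue R) =
    lo ∷ s , ≤-refl ∷ All.map <⇒≤ lo , s≤s (ℕ.m≤m+n i _) ∷ hi
  select-piAux (false ∷ R) i j = select-piAux R i (suc j)

  select-co-piAux : ∀ R i j → AllPairs _<_ (select (complement R) (piAux R p i j)) ×
    All (p ℕ.+ j <_) (select (complement R) (piAux R p i j))
  select-co-piAux []          i j = [] , []
  select-co-piAux (true  ∷ R) i j = select-co-piAux R (suc i) j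
  select-co-piAux (false ∷ R) i j with s , lo ← select-co-piAux R i (suc j) =
    lo ∷ s , ℕ.+-monoʳ-< p ≤-refl ∷ All.map (<-trans (ℕ.+-monoʳ-< p ≤-refl)) lo

-- Both subwords of π_R increase, so by `Fits-sorted` the conditions among marked nodes and among
-- unmarked nodes hold by themselves, and only the mixed pairs are tested.
Fits-piR⇔Admissible : ∀ {t} (m : Marking t) → Fits t (piR (marks m)) ⇔ Admissible m
Fits-piR⇔Admissible {t} m = mk⇔ (Fits⇒Admissible m separated)
  (λ ok → Admissible⇒Fits m len separated ok
    (Fits-sorted _ (length-select-marks m len) (proj₁ below))
    (Fits-sorted _ (length-select-marks (co m) len)
      (subst (λ R → AllPairs _<_ (select R π)) (sym (marks-co m)) (proj₁ above))))
  where
  p = countTrue (marks m)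
  π = piR (marks m)
  below = select-piAux p (marks m) 0 0
  above = select-co-piAux p (marks m) 0 0
  len : length π ≡ size t
  len = trans (length-piAux p (marks m) 0 0) (length-marks m)
  separated : Separated m π
  separated = subst (λ R → All (λ x → All (x <_) (select R π)) (select (marks m) π)) (sym (marks-co m))
    (All.map (λ x≤p → All.map (λ {y} lt → ≤-<-trans x≤p (subst (_< y) (ℕ.+-identityʳ p) lt)) (proj₂ above))
      (proj₂ (proj₂ below)))

-- Separation alone decides the mixed pairs, so their condition is the same for every separated
-- labelling; `piR` serves as the representative.
Fits-separated⇔ : ∀ {t ω} (m : Marking t) → length ω ≡ size t → Separated m ω →
  Fits t ω ⇔ (Fits t (piR (marks m)) × Fits (restrict m) (select (marks m) ω) ×
              Fits (restrict (co m)) (select (marks (co m)) ω))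
Fits-separated⇔ m le sep = mk⇔
  (λ f → from (Fits-piR⇔Admissible m) (Fits⇒Admissible m sep f) , Fits-restrict m f , Fits-restrict (co m) f)
  (λ (π , f , g) → Admissible⇒Fits m le sep (to (Fits-piR⇔Admissible m) π) f g)

-- Shuffles and subsets

length-oneTo : ∀ n → length (oneTo n) ≡ n
length-oneTo n = trans (length-map suc (upTo n)) (length-upTo n)

oneTo-sorted : ∀ n → AllPairs _<_ (oneTo n)
oneTo-sorted n = AllPairs.map⁺ (AllPairs.applyUpTo⁺₁ id n (λ i<j _ → s≤s i<j))

oneTo-unique : ∀ n → Unique (oneTo n)
oneTo-unique n = AllPairs.map (λ lt eq → <-irrefl eq lt) (oneTo-sorted n)

oneTo-suc : ∀ n → oneTo n ++ suc n ∷ [] ≡ oneTo (suc n)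
oneTo-suc n = trans (sym (map-++ suc (upTo n) (n ∷ []))) (cong (map suc) (upTo-∷ʳ n))

∈-insertAll⁺ : ∀ {v} a b → a ++ v ∷ b ∈ insertAll v (a ++ b)
∈-insertAll⁺ []      []      = here refl
∈-insertAll⁺ []      (x ∷ b) = here refl
∈-insertAll⁺ (x ∷ a) b       = there (∈-map⁺ (x ∷_) (∈-insertAll⁺ a b))

∈-insertAll⁻ : ∀ {v} ω {ζ} → ζ ∈ insertAll v ω → ∃₂ λ a b → ω ≡ a ++ b × ζ ≡ a ++ v ∷ b
∈-insertAll⁻ []      (here refl) = [] , [] , refl , refl
∈-insertAll⁻ (x ∷ ω) (here refl) = [] , x ∷ ω , refl , refl
∈-insertAll⁻ (x ∷ ω) (there i) with ζ , j , refl ← ∈-map⁻ (x ∷_) i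
  with a , b , refl , refl ← ∈-insertAll⁻ ω j = x ∷ a , b , refl , refl

insertAll-unique : ∀ {v} ω → ¬ v ∈ ω → Unique (insertAll v ω)
insertAll-unique []      _  = [] ∷ []
insertAll-unique (x ∷ ω) v∉ =
  All.tabulate (λ i eq → case ∈-map⁻ (x ∷_) i of λ (_ , _ , eq′) → v∉ (here (∷-injectiveˡ (trans eq eq′)))) ∷
  Unique.map⁺ ∷-injectiveʳ (insertAll-unique ω (v∉ ∘ there))

-- The fresh letter occurs once, so its position determines the word before insertion.
insertAll-injective : ∀ {v ω ω′ ζ} → ¬ v ∈ ω → ¬ v ∈ ω′ → ζ ∈ insertAll v ω → ζ ∈ insertAll v ω′ → ω ≡ ω′
insertAll-injective {v} {ω} {ω′} v∉ v∉′ i j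
  with a , b , refl , refl ← ∈-insertAll⁻ ω i | c , d , refl , eq ← ∈-insertAll⁻ ω′ j with position a c eq
... | same refl refl refl = refl
... | before e refl _     = contradiction (∈-++⁺ˡ (∈-insert c)) v∉
... | after k             = contradiction (∈-++⁺ˡ k) v∉′

∈-perms⁻ : ∀ n {ζ} → ζ ∈ perms n → ζ ↭ oneTo n
∈-perms⁻ zero    (here refl) = ↭.refl
∈-perms⁻ (suc n) i with ω , ω∈ , j ← find (∈-concatMap⁻ (insertAll (suc n)) {xs = perms n} i)
  with a , b , refl , refl ← ∈-insertAll⁻ ω j =
  ↭-trans (shift (suc n) a b) (↭-trans (prep (suc n) (∈-perms⁻ n ω∈))
    (↭-trans (↭-sym (↭-trans (shift (suc n) (oneTo n) []) (prep _ (↭-reflexive (++-identityʳ _)))))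
             (↭-reflexive (oneTo-suc n))))

∈-perms⁺ : ∀ n {ζ} → ζ ↭ oneTo n → ζ ∈ perms n
∈-perms⁺ zero    p with refl ← ↭-empty-inv p = here refl
∈-perms⁺ (suc n) p with p′ ← ↭-trans p (↭-reflexive (sym (oneTo-suc n)))
  with a , b , refl ← ∈-∃++ (∈-resp-↭ (↭-sym p′) (∈-insert (oneTo n))) =
  ∈-concatMap⁺ (insertAll (suc n)) (lose
    (∈-perms⁺ n (↭-trans (drop-mid a (oneTo n) p′) (↭-reflexive (++-identityʳ _)))) (∈-insertAll⁺ a b))

perms-unique : ∀ n → Unique (perms n)
perms-unique zero    = [] ∷ []
perms-unique (suc n) = concatMap-unique (perms-unique n) (λ ω ω∈ → insertAll-unique ω (fresh ω∈))
  (λ _ _ i j → insertAll-injective (fresh i) (fresh j))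
  where
  fresh : ∀ {ω} → ω ∈ perms n → ¬ suc n ∈ ω
  fresh ω∈ i with j , j∈ , refl ← ∈-map⁻ suc (∈-resp-↭ (∈-perms⁻ n ω∈) i) = <-irrefl refl (∈-upTo⁻ j∈)

∈-subsets⁻ : ∀ n {R} → R ∈ subsets n → length R ≡ n
∈-subsets⁻ zero    (here refl) = refl
∈-subsets⁻ (suc n) i with find (∈-concatMap⁻ (λ b → (true ∷ b) ∷ (false ∷ b) ∷ []) {xs = subsets n} i)
... | _ , j , here refl         = cong suc (∈-subsets⁻ n j)
... | _ , j , there (here refl) = cong suc (∈-subsets⁻ n j)

∈-subsets⁺ : ∀ R → R ∈ subsets (length R)
∈-subsets⁺ []          = here refl
∈-subsets⁺ (true  ∷ R) = ∈-concatMap⁺ _ (lose (∈-subsets⁺ R) (here refl))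
∈-subsets⁺ (false ∷ R) = ∈-concatMap⁺ _ (lose (∈-subsets⁺ R) (there (here refl)))

subsets-unique : ∀ n → Unique (subsets n)
subsets-unique zero    = [] ∷ []
subsets-unique (suc n) = concatMap-unique (subsets-unique n) (λ _ _ → ((λ ()) ∷ []) ∷ [] ∷ [])
  (λ { _ _ _ _ (here refl) (here refl) → refl
     ; _ _ _ _ (here refl) (there (here ()))
     ; _ _ _ _ (there (here refl)) (there (here refl)) → refl })

select-⊆ : ∀ R {ω x} → x ∈ select R ω → x ∈ ω
select-⊆ R {ω} i = All.lookup (select-All R (All.tabulate id)) i

select-injective : ∀ R R′ {ω} → length R ≡ length ω → length R′ ≡ length ω → Unique ω →
  select R ω ≡ select R′ ω → R ≡ R′
select-injective []          []           {[]}    _  _   _       _  = refl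
select-injective (true  ∷ R) (true  ∷ R′) {x ∷ ω} le le′ (_ ∷ u) eq =
  cong (true ∷_) (select-injective R R′ (suc-injective le) (suc-injective le′) u (∷-injectiveʳ eq))
select-injective (false ∷ R) (false ∷ R′) {x ∷ ω} le le′ (_ ∷ u) eq =
  cong (false ∷_) (select-injective R R′ (suc-injective le) (suc-injective le′) u eq)
select-injective (true  ∷ R) (false ∷ R′) {x ∷ ω} le le′ (x∉ ∷ u) eq =
  contradiction refl (All.lookup x∉ (select-⊆ R′ (subst (x ∈_) eq (here refl))))
select-injective (false ∷ R) (true  ∷ R′) {x ∷ ω} le le′ (x∉ ∷ u) eq =
  contradiction refl (All.lookup x∉ (select-⊆ R (subst (x ∈_) (sym eq) (here refl))))

select-↭ : ∀ R ω → length R ≡ length ω → select R ω ++ select (complement R) ω ↭ ω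
select-↭ []          []      _  = ↭.refl
select-↭ (true  ∷ R) (x ∷ ω) le = prep x (select-↭ R ω (suc-injective le))
select-↭ (false ∷ R) (x ∷ ω) le = ↭-trans (shift x (select R ω) _) (prep x (select-↭ R ω (suc-injective le)))

select-sorted : ∀ R {ω} → AllPairs _<_ ω → AllPairs _<_ (select R ω)
select-sorted []          _       = []
select-sorted (true  ∷ R) []      = []
select-sorted (false ∷ R) []      = []
select-sorted (true  ∷ R) (p ∷ s) = select-All R p ∷ select-sorted R s
select-sorted (false ∷ R) (p ∷ s) = select-sorted R s

private
  sorted-head : ∀ {x y xs ys} → All (x <_) xs → AllPairs _<_ (y ∷ ys) → x ∈ y ∷ ys → y ∈ x ∷ xs → x ≡ y
  sorted-head _  _         (here refl) _           = refl
  sorted-head _  _         (there _)   (here refl) = refl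
  sorted-head x< (y< ∷ _)  (there i)   (there j)   = contradiction (All.lookup x< j) (ℕ.<-asym (All.lookup y< i))

-- The least letter of `ω` must head `a` or `b`, since both increase. Which of them it heads is the
-- first entry of R.
unshuffle : ∀ {ω} a b → AllPairs _<_ ω → a ++ b ↭ ω → AllPairs _<_ a → AllPairs _<_ b →
  ∃ λ R → length R ≡ length ω × select R ω ≡ a × select (complement R) ω ≡ b
unshuffle {[]} a b _ p _ _ with refl ← ++-conicalˡ a b (↭-empty-inv p) | refl ← ++-conicalʳ a b (↭-empty-inv p) =
  [] , refl , refl , refl
unshuffle {x ∷ ω} a b (x< ∷ s) p sa sb with ∈-++⁻ a (∈-resp-↭ (↭-sym p) (here refl))
unshuffle {x ∷ ω} (y ∷ a) b (x< ∷ s) p sa@(_ ∷ sa′) sb | inj₁ i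
  with refl ← sorted-head x< sa i (∈-resp-↭ p (here refl))
  with R , le , refl , refl ← unshuffle a b s (drop-∷ p) sa′ sb = true ∷ R , cong suc le , refl , refl
unshuffle {x ∷ ω} a (y ∷ b) (x< ∷ s) p sa sb@(_ ∷ sb′) | inj₂ i
  with refl ← sorted-head x< sb i (∈-resp-↭ p (∈-insert a))
  with R , le , refl , refl ← unshuffle a b s (drop-mid a [] p) sa sb′ = false ∷ R , cong suc le , refl , refl

-- Positions are one-based, hence `suc j`. The value `p = 0` excepts nothing and means that the
-- whole word increases.
AscendsExceptAt : ℕ → List ℕ → Set
AscendsExceptAt p ζ = ∀ j → suc j < length ζ → suc j ≢ p → at ζ (suc j) < at ζ (suc (suc j))

isShuffle⇔ : ∀ p ζ → T (isShuffle p ζ) ⇔ AscendsExceptAt p ζ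
isShuffle⇔ p ζ = mk⇔
  (λ t j lt ne → case to T-∨ (All.lookup (All.all⁺ _ _ t) (∈-map⁺ suc (∈-upTo⁺ (ℕ.∸-monoˡ-≤ 1 lt)))) of λ
    { (inj₁ eq) → contradiction (ℕ.≡ᵇ⇒≡ (suc j) p eq) ne
    ; (inj₂ u)  → ℕ.<ᵇ⇒< _ _ u })
  (λ asc → All.all⁻ _ (All.map⁺ (All.tabulate λ {j} i → from T-∨ (case suc j ℕ.≟ p of λ
    { (yes eq) → inj₁ (ℕ.≡⇒≡ᵇ (suc j) p eq)
    ; (no ne)  → inj₂ (ℕ.<⇒<ᵇ (asc j (small ζ (∈-upTo⁻ i)) ne)) }))))
  where
  small : ∀ (ζ : List ℕ) {j} → j < length ζ ∸ 1 → suc j < length ζ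
  small (_ ∷ _) lt = s≤s lt

private
  ascends⇒linked : ∀ ζ → AscendsExceptAt 0 ζ → Linked _<_ ζ
  ascends⇒linked []          _ = []
  ascends⇒linked (x ∷ [])    _ = [-]
  ascends⇒linked (x ∷ y ∷ ζ) h =
    h 0 (s≤s (s≤s z≤n)) (λ ()) ∷ ascends⇒linked (y ∷ ζ) (λ j lt _ → h (suc j) (s≤s lt) (λ ()))

  linked⇒ascends : ∀ {p} ζ → Linked _<_ ζ → AscendsExceptAt p ζ
  linked⇒ascends (x ∷ [])    _       j       (s≤s ())
  linked⇒ascends (x ∷ y ∷ ζ) (p ∷ _) zero    _        _  = p
  linked⇒ascends (x ∷ y ∷ ζ) (_ ∷ s) (suc j) (s≤s lt) _  = linked⇒ascends {0} (y ∷ ζ) s j lt (λ ())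

ascends⇔linked : ∀ a b → AscendsExceptAt (length a) (a ++ b) ⇔ (Linked _<_ a × Linked _<_ b)
ascends⇔linked a b = mk⇔ (split a) (λ (la , lb) → join a la lb)
  where
  split : ∀ a → AscendsExceptAt (length a) (a ++ b) → Linked _<_ a × Linked _<_ b
  split []          h = [] , ascends⇒linked b h
  split (x ∷ [])    h = [-] , ascends⇒linked b (λ j lt _ → h (suc j) (s≤s lt) (λ ()))
  split (x ∷ y ∷ a) h with la , lb ← split (y ∷ a) (λ j lt ne → h (suc j) (s≤s lt) (ne ∘ suc-injective)) =
    h 0 (s≤s (s≤s z≤n)) (λ ()) ∷ la , lb
  join : ∀ a → Linked _<_ a → Linked _<_ b → AscendsExceptAt (length a) (a ++ b)
  join []          _        lb = linked⇒ascends b lb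
  join (x ∷ [])    _        lb zero    _        ne = contradiction refl ne
  join (x ∷ [])    _        lb (suc j) (s≤s lt) ne = linked⇒ascends {0} b lb j lt (λ ())
  join (x ∷ y ∷ a) (p ∷ _)  lb zero    _        _  = p
  join (x ∷ y ∷ a) (_ ∷ la) lb (suc j) (s≤s lt) ne = join (y ∷ a) la lb j lt (ne ∘ cong suc)

-- The shuffle ζ with ζ([p]) = R, that is, the inverse of π_R.
shuffleOf : List Bool → Perm
shuffleOf R = select R (oneTo (length R)) ++ select (complement R) (oneTo (length R))

map-unique : ∀ {A B : Set} {f : A → B} {xs} → (∀ {x y} → x ∈ xs → y ∈ xs → f x ≡ f y → x ≡ y) → Unique xs → Unique (map f xs)
map-unique inj [] = []
map-unique inj (x∉ ∷ u) =
  All.map⁺ (All.tabulate (λ i eq → All.lookup x∉ i (inj (here refl) (there i) eq))) ∷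
  map-unique (λ i j → inj (there i) (there j)) u

shufflesOf : ℕ → ℕ → List Perm
shufflesOf p q = map shuffleOf (filter (λ R → countTrue R ℕ.≟ p) (subsets (p ℕ.+ q)))

private
  length-oneTo-R : ∀ (R : List Bool) → length R ≡ length (oneTo (length R))
  length-oneTo-R R = sym (length-oneTo (length R))

∈-Sh⇔∈-shufflesOf : ∀ p q {ζ} → ζ ∈ Sh p q ⇔ ζ ∈ shufflesOf p q
∈-Sh⇔∈-shufflesOf p q = mk⇔ ⊆ ⊇
  where
  n = p ℕ.+ q
  ⊆ : ∀ {ζ} → ζ ∈ Sh p q → ζ ∈ shufflesOf p q
  ⊆ {ζ} i with ζ∈ , sh ← ∈-filter⁻ _ {xs = perms n} i with perm ← ∈-perms⁻ n ζ∈
    with a , b , refl , la , _ ← ++-split p {ω = ζ} (trans (↭-length perm) (length-oneTo n))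
    with sa , sb ← to (ascends⇔linked a b)
           (subst (λ k → AscendsExceptAt k (a ++ b)) (sym la) (to (isShuffle⇔ p (a ++ b)) (from T-≡ sh)))
    with R , le , eqa , eqb ← unshuffle a b (oneTo-sorted n) perm (Linked⇒AllPairs <-trans sa) (Linked⇒AllPairs <-trans sb) =
    subst (_∈ shufflesOf p q)
      (trans (cong (λ k → select R (oneTo k) ++ select (complement R) (oneTo k)) (trans le (length-oneTo n)))
             (cong₂ _++_ eqa eqb))
      (∈-map⁺ shuffleOf (∈-filter⁺ (λ R → countTrue R ℕ.≟ p)
        (subst (λ k → R ∈ subsets k) (trans le (length-oneTo n)) (∈-subsets⁺ R))
        (trans (sym (length-select R le)) (trans (cong length eqa) la))))
  ⊇ : ∀ {ζ} → ζ ∈ shufflesOf p q → ζ ∈ Sh p q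
  ⊇ i with R , j , refl ← ∈-map⁻ shuffleOf i with R∈ , ct ← ∈-filter⁻ _ {xs = subsets n} j
    with len ← ∈-subsets⁻ n R∈ =
    ∈-filter⁺ _ (∈-perms⁺ n (↭-trans (select-↭ R _ (length-oneTo-R R)) (↭-reflexive (cong oneTo len))))
      (to T-≡ (from (isShuffle⇔ p (shuffleOf R)) (subst (λ k → AscendsExceptAt k (shuffleOf R))
        (trans (length-select R (length-oneTo-R R)) ct)
        (from (ascends⇔linked (select R (oneTo (length R))) _)
          (AllPairs⇒Linked (select-sorted R (oneTo-sorted _)) , AllPairs⇒Linked (select-sorted (complement R) (oneTo-sorted _)))))))

-- Repetition-free lists with the same members are permutations of each other, which is what
-- reindexing a sum requires. `shuffleOf` is injective because its first `p` letters are the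
-- elements of R.
Sh-↭ : ∀ p q → Sh p q ↭ shufflesOf p q
Sh-↭ p q = ∼bag⇒↭ (unique∧set⇒bag (Unique.filter⁺ _ (perms-unique n))
  (map-unique injective (Unique.filter⁺ _ (subsets-unique n))) (∈-Sh⇔∈-shufflesOf p q))
  where
  n = p ℕ.+ q
  injective : ∀ {R R′} → R ∈ filter (λ R → countTrue R ℕ.≟ p) (subsets n) → R′ ∈ filter (λ R → countTrue R ℕ.≟ p) (subsets n) →
    shuffleOf R ≡ shuffleOf R′ → R ≡ R′
  injective {R} {R′} i j eq = select-injective R R′ (length-oneTo-R R) le′ (oneTo-unique _)
    (proj₁ (++-injective _ _
      (trans (length-select R (length-oneTo-R R)) (trans count≡ (sym (length-select R′ le′))))
      (trans eq (cong (λ k → select R′ (oneTo k) ++ select (complement R′) (oneTo k)) (sym len≡)))))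
    where
    R∈  = ∈-filter⁻ _ {xs = subsets n} i
    R′∈ = ∈-filter⁻ _ {xs = subsets n} j
    count≡ : countTrue R ≡ countTrue R′
    count≡ = trans (proj₂ R∈) (sym (proj₂ R′∈))
    len≡ : length R ≡ length R′
    len≡ = trans (∈-subsets⁻ n (proj₁ R∈)) (sym (∈-subsets⁻ n (proj₁ R′∈)))
    le′ : length R′ ≡ length (oneTo (length R))
    le′ = trans (sym len≡) (length-oneTo-R R)

-- The terms of the product F_s · F_t

pos-∈ : ∀ {v ζ} → v ∈ ζ → ∃ λ k → pos v ζ ≡ suc k
pos-∈ {v} {x ∷ ζ} i with x ≡ᵇ v in eq
... | true  = 0 , refl
pos-∈ {v} {x ∷ ζ} (here refl) | false = case subst T eq (ℕ.≡⇒≡ᵇ x x refl) of λ ()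
pos-∈ {v} {x ∷ ζ} (there i) | false with k , e ← pos-∈ i rewrite e = suc k , refl

-- This is σ·ζ⁻¹·ζ = σ, letter by letter; without repetitions, `pos` finds each letter at its own
-- index.
map-at-pos : ∀ σ {ζ} → Unique ζ → length ζ ≡ length σ → map (λ v → at σ (pos v ζ)) ζ ≡ σ
map-at-pos [] {[]} _ _ = refl
map-at-pos (y ∷ σ) {x ∷ ζ} (x∉ ∷ u) le = cong₂ _∷_ at-head
  (trans (map-cong-local (All.tabulate at-tail)) (map-at-pos σ u (suc-injective le)))
  where
  at-head : at (y ∷ σ) (pos x (x ∷ ζ)) ≡ y
  at-head rewrite to T-≡ (ℕ.≡⇒≡ᵇ x x refl) = refl
  at-tail : ∀ {v} → v ∈ ζ → at (y ∷ σ) (pos v (x ∷ ζ)) ≡ at σ (pos v ζ)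
  at-tail {v} i with x ≡ᵇ v in eq
  ... | true = contradiction (ℕ.≡ᵇ⇒≡ x v (from T-≡ eq)) (All.lookup x∉ i)
  ... | false with k , e ← pos-∈ i rewrite e = refl

select-map : ∀ (f : ℕ → ℕ) R ω → select R (map f ω) ≡ map f (select R ω)
select-map f []          ω       = refl
select-map f (true  ∷ R) []      = refl
select-map f (false ∷ R) []      = refl
select-map f (true  ∷ R) (x ∷ ω) = cong (f x ∷_) (select-map f R ω)
select-map f (false ∷ R) (x ∷ ω) = select-map f R ω

productWord : BT → BT → Perm → Perm
productWord s t ζ = compose (slash (gam s) (gam t)) (inv ζ)

module _ (s t : BT) (R : List Bool) (ct : countTrue R ≡ size s) (len : length R ≡ size s ℕ.+ size t) where

  private
    n = length R
    ζ = shuffleOf R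
    σ = gam s
    τ = map (ℕ._+ length σ) (gam t)
    f : ℕ → ℕ
    f v = at (slash (gam s) (gam t)) (pos v ζ)

    perm : ζ ↭ oneTo n
    perm = select-↭ R (oneTo n) (sym (length-oneTo n))

    length-ζ : length ζ ≡ n
    length-ζ = trans (↭-length perm) (length-oneTo n)

    word≡ : productWord s t ζ ≡ map f (oneTo n)
    word≡ = trans (sym (map-∘ (oneTo (length ζ)))) (cong (λ k → map f (oneTo k)) length-ζ)

    -- Reading `f` along ζ instead of along 1, ..., n undoes ζ⁻¹ and returns γ(s)/γ(t). Its two
    -- blocks are therefore the letters of the product word at the positions in R and in the
    -- complement.
    parts : map f (select R (oneTo n)) ≡ σ × map f (select (complement R) (oneTo n)) ≡ τ
    parts = ++-injective _ σ
      (trans (length-map f (select R (oneTo n))) (trans (length-select R (sym (length-oneTo n))) (trans ct (sym (length-gam s)))))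
      (trans (sym (map-++ f (select R (oneTo n)) _)) (map-at-pos (slash (gam s) (gam t))
        (Permutationₛ.Unique-resp-↭ (setoid ℕ) (↭⇒↭ₛ (↭-sym perm)) (oneTo-unique n))
        (trans length-ζ (trans len (sym (trans (length-++ σ)
          (cong₂ ℕ._+_ (length-gam s) (trans (length-map _ (gam t)) (length-gam t)))))))))

  length-productWord : length (productWord s t ζ) ≡ n
  length-productWord = trans (cong length word≡) (trans (length-map f (oneTo n)) (length-oneTo n))

  select-productWord : select R (productWord s t ζ) ≡ gam s
  select-productWord = trans (cong (select R) word≡) (trans (select-map f R _) (proj₁ parts))

  select-co-productWord : select (complement R) (productWord s t ζ) ≡ map (ℕ._+ length (gam s)) (gam t)
  select-co-productWord = trans (cong (select (complement R)) word≡) (trans (select-map f (complement R) _) (proj₂ parts))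

Fits-shift⇔ : ∀ c {u ω} → Fits u (map (ℕ._+ c) ω) ⇔ Fits u ω
Fits-shift⇔ c {u} {ω} = mk⇔
  (λ p → subst (Fits u) (map-id ω) (Fits-transport (ℕ._+ c) id ω (λ {x} {y} _ _ → ℕ.+-cancelʳ-< c x y) p))
  (λ p → Fits-transport id (ℕ._+ c) ω (λ _ _ → ℕ.+-monoˡ-< c) (subst (Fits u) (sym (map-id ω)) p))

-- The product word is separated: its marked letters form γ(s), with values up to `size s`, and its
-- unmarked letters form γ(t) raised by `size s`. Each factor of `Fits-separated⇔` then becomes one
-- Tamari comparison.
productWord-≤T : ∀ s t r R → countTrue R ≡ size s → length R ≡ size s ℕ.+ size t → size r ≡ size s ℕ.+ size t →
  (lam (productWord s t (shuffleOf R)) ≤T r) ≡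
  (lam (piR R) ≤T r) ∧ ((s ≤T restrictT r R) ∧ (t ≤T restrictT r (complement R)))
productWord-≤T s t r R ct len sz with m , refl ← marks-surjective r {R} (trans len (sym sz)) = T-injective forth back
  where
  T-injective : ∀ {a b} → (T a → T b) → (T b → T a) → a ≡ b
  T-injective f g = ⇔→≡ (mk⇔ (to T-≡ ∘ f ∘ from T-≡) (to T-≡ ∘ g ∘ from T-≡))
  ω = productWord s t (shuffleOf (marks m))
  c = length (gam s)
  selected : select (marks m) ω ≡ gam s
  selected = select-productWord s t (marks m) ct len
  unselected : select (marks (co m)) ω ≡ map (ℕ._+ c) (gam t)
  unselected = trans (cong (λ S → select S ω) (marks-co m)) (select-co-productWord s t (marks m) ct len)
  restrict-co : restrictT r (complement (marks m)) ≡ restrict (co m)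
  restrict-co = trans (cong (restrictT r) (sym (marks-co m))) (restrictT≡restrict (co m))
  separated : Separated m ω
  separated = subst₂ (λ u v → All (λ x → All (x <_) v) u) (sym selected) (sym unselected)
    (All.map (λ x≤ → All.map⁺ (All.map (λ 0<y → ≤-<-trans (subst (_ ≤_) (sym (length-gam s)) x≤) (ℕ.+-monoˡ-< c 0<y)) (gam-positive t)))
      (gam-bounded s))
  key = Fits-separated⇔ m (trans (length-productWord s t (marks m) ct len) (trans len (sym sz))) separated
  forth : T (lam ω ≤T r) → _
  forth p with π , f , g ← to key (to lam-≼⇔Fits (to ≤T⇔≼ p)) = from T-∧
    ( from ≤T⇔≼ (from lam-≼⇔Fits π)
    , from T-∧ ( from ≤T⇔≼ (subst (s ≼_) (sym (restrictT≡restrict m)) (to Fits-gam⇔≼ (subst (Fits _) selected f)))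
               , from ≤T⇔≼ (subst (t ≼_) (sym restrict-co)
                   (to Fits-gam⇔≼ (to (Fits-shift⇔ c) (subst (Fits _) unselected g))))))
  back : _ → T (lam ω ≤T r)
  back p with π , p′ ← to T-∧ p with f , g ← to T-∧ p′ = from ≤T⇔≼ (from lam-≼⇔Fits (from key
    ( to lam-≼⇔Fits (to ≤T⇔≼ π)
    , subst (Fits _) (sym selected) (from Fits-gam⇔≼ (subst (s ≼_) (restrictT≡restrict m) (to ≤T⇔≼ f)))
    , subst (Fits _) (sym unselected) (from (Fits-shift⇔ c)
        (from Fits-gam⇔≼ (subst (t ≼_) restrict-co (to ≤T⇔≼ g)))))))

size-restrictT : ∀ r R → length R ≡ size r → size (restrictT r R) ≡ countTrue R
size-restrictT r R len with m , refl ← marks-surjective r {R} len = trans (cong size (restrictT≡restrict m)) (size-restrict m)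

-- Finite sums

∑ : ∀ {A : Set} → List A → (A → ℚ) → ℚ
∑ xs f = sumℚ (map f xs)

⟦_⟧ : Bool → ℚ
⟦ b ⟧ = if b then 1ℚ else 0ℚ

⟦⟧-yes : ∀ {b} → T b → ⟦ b ⟧ ≡ 1ℚ
⟦⟧-yes {true} _ = refl

⟦⟧-no : ∀ {b} → ¬ T b → ⟦ b ⟧ ≡ 0ℚ
⟦⟧-no {true}  ¬t = contradiction tt ¬t
⟦⟧-no {false} _  = refl

⟦⟧-∧ : ∀ a b → ⟦ a ∧ b ⟧ ≡ ⟦ a ⟧ * ⟦ b ⟧
⟦⟧-∧ true  b = sym (ℚ.*-identityˡ ⟦ b ⟧)
⟦⟧-∧ false b = sym (ℚ.*-zeroˡ ⟦ b ⟧)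

if-⟦⟧ : ∀ b {x : ℚ} → (if b then x else 0ℚ) ≡ ⟦ b ⟧ * x
if-⟦⟧ true  {x} = sym (ℚ.*-identityˡ x)
if-⟦⟧ false {x} = sym (ℚ.*-zeroˡ x)

private
  module +-Semigroup = CommutativeSemigroupProperties (CommutativeRing.+-commutativeSemigroup ℚ.+-*-commutativeRing)
  module *-Semigroup = CommutativeSemigroupProperties (CommutativeRing.*-commutativeSemigroup ℚ.+-*-commutativeRing)

0*-≡0 : ∀ {a} b → a ≡ 0ℚ → a * b ≡ 0ℚ
0*-≡0 b refl = ℚ.*-zeroˡ b

*0-≡0 : ∀ a {b} → b ≡ 0ℚ → a * b ≡ 0ℚ
*0-≡0 a refl = ℚ.*-zeroʳ a

module _ {A : Set} where

  ∑-cong : ∀ {f g : A → ℚ} xs → (∀ {x} → x ∈ xs → f x ≡ g x) → ∑ xs f ≡ ∑ xs g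
  ∑-cong xs h = cong sumℚ (map-cong-local (All.tabulate h))

  ∑-zero : ∀ {f : A → ℚ} xs → (∀ {x} → x ∈ xs → f x ≡ 0ℚ) → ∑ xs f ≡ 0ℚ
  ∑-zero []       h = refl
  ∑-zero (x ∷ xs) h = trans (cong₂ _+_ (h (here refl)) (∑-zero xs (h ∘ there))) (ℚ.+-identityˡ 0ℚ)

  ∑-+ : ∀ (f g : A → ℚ) xs → ∑ xs (λ x → f x + g x) ≡ ∑ xs f + ∑ xs g
  ∑-+ f g []       = sym (ℚ.+-identityˡ 0ℚ)
  ∑-+ f g (x ∷ xs) = trans (cong ((f x + g x) +_) (∑-+ f g xs)) (+-Semigroup.interchange (f x) (g x) _ _)

  ∑-*ˡ : ∀ c (f : A → ℚ) xs → c * ∑ xs f ≡ ∑ xs (λ x → c * f x)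
  ∑-*ˡ c f []       = ℚ.*-zeroʳ c
  ∑-*ˡ c f (x ∷ xs) = trans (ℚ.*-distribˡ-+ c (f x) _) (cong ((c * f x) +_) (∑-*ˡ c f xs))

  ∑-*ʳ : ∀ c (f : A → ℚ) xs → ∑ xs f * c ≡ ∑ xs (λ x → f x * c)
  ∑-*ʳ c f xs = trans (ℚ.*-comm (∑ xs f) c) (trans (∑-*ˡ c f xs) (∑-cong xs (λ {x} _ → ℚ.*-comm c (f x))))

  ∑-↭ : ∀ (f : A → ℚ) {xs ys} → xs ↭ ys → ∑ xs f ≡ ∑ ys f
  ∑-↭ f p = Permutationₛ.foldr-commMonoid (setoid ℚ) ℚ.+-0-isCommutativeMonoid (↭⇒↭ₛ (map⁺ f p))

  ∑-filter : ∀ {P : A → Set} (P? : ∀ x → Dec (P x)) {f : A → ℚ} xs → (∀ {x} → x ∈ xs → ¬ P x → f x ≡ 0ℚ) →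
    ∑ (filter P? xs) f ≡ ∑ xs f
  ∑-filter P? []       h = refl
  ∑-filter P? {f} (x ∷ xs) h with P? x
  ... | yes _ = cong (f x +_) (∑-filter P? xs (h ∘ there))
  ... | no ¬p = trans (∑-filter P? xs (h ∘ there))
                  (sym (trans (cong (_+ ∑ xs f) (h (here refl) ¬p)) (ℚ.+-identityˡ _)))

  ∑-single : ∀ {f : A → ℚ} {x xs} → Unique xs → x ∈ xs → (∀ {y} → y ∈ xs → y ≢ x → f y ≡ 0ℚ) → ∑ xs f ≡ f x
  ∑-single {f} {xs = x ∷ xs} (x∉ ∷ _) (here refl) h =
    trans (cong (f x +_) (∑-zero xs (λ i → h (there i) (All.lookup x∉ i ∘ sym)))) (ℚ.+-identityʳ (f x))
  ∑-single {f} {xs = y ∷ xs} (y∉ ∷ u) (there i) h =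
    trans (cong₂ _+_ (h (here refl) (All.lookup y∉ i)) (∑-single u i (h ∘ there))) (ℚ.+-identityˡ _)

  -- One elimination step in a triangular system; used to read off the diagonal term of a Möbius
  -- transform.
  ∑-isolate : ∀ {f g : A → ℚ} {x xs} → Unique xs → x ∈ xs → (∀ {y} → y ∈ xs → y ≢ x → f y ≡ g y) →
    ∑ xs f ≡ ∑ xs g → f x ≡ g x
  ∑-isolate {f} {g} {xs = x ∷ xs} (x∉ ∷ _) (here refl) h eq = +-cancelʳ (∑ xs g) (f x) (g x)
    (trans (cong (f x +_) (sym (∑-cong xs (λ i → h (there i) (All.lookup x∉ i ∘ sym))))) eq)
    where open import Algebra.Properties.Group ℚ.+-0-group using () renaming (∙-cancelʳ to +-cancelʳ)
  ∑-isolate {f} {g} {xs = y ∷ xs} (y∉ ∷ u) (there i) h eq = ∑-isolate u i (h ∘ there)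
    (+-cancelˡ (g y) (∑ xs f) (∑ xs g) (trans (cong (_+ ∑ xs f) (sym (h (here refl) (All.lookup y∉ i)))) eq))
    where open import Algebra.Properties.Group ℚ.+-0-group using () renaming (∙-cancelˡ to +-cancelˡ)

∑-map : ∀ {A B : Set} (g : A → B) (f : B → ℚ) xs → ∑ (map g xs) f ≡ ∑ xs (f ∘ g)
∑-map g f xs = cong sumℚ (sym (map-∘ xs))

∑-swap : ∀ {A B : Set} (f : A → B → ℚ) xs ys → ∑ xs (λ x → ∑ ys (f x)) ≡ ∑ ys (λ y → ∑ xs (λ x → f x y))
∑-swap f []       ys = sym (∑-zero ys (λ _ → refl))
∑-swap f (x ∷ xs) ys = trans (cong (∑ ys (f x) +_) (∑-swap f xs ys)) (sym (∑-+ (f x) _ ys))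

-- The division in `ℕtoℚ` reduces to lowest terms, which is stuck for a variable `k`; among
-- unnormalised rationals the claim is an identity of integers.
ℕtoℚ-suc : ∀ k → ℕtoℚ (suc k) ≡ 1ℚ + ℕtoℚ k
ℕtoℚ-suc k = ℚ.toℚᵘ-injective (begin
  toℚᵘ (ℕtoℚ (suc k))                        ≈⟨ ℚ.toℚᵘ-fromℚᵘ (ℚᵘ.mkℚᵘ (posℤ (suc k)) 0) ⟩
  ℚᵘ.mkℚᵘ (posℤ (suc k)) 0                          ≈⟨ ℚᵘ.*≡* (cong (λ i → (posℤ 1 ℤ.+ i) ℤ.* posℤ 1) (sym (ℤ.*-identityʳ (posℤ k)))) ⟩
  ℚᵘ.1ℚᵘ ℚᵘ.+ ℚᵘ.mkℚᵘ (posℤ k) 0                  ≈⟨ ℚᵘ.+-congʳ ℚᵘ.1ℚᵘ (ℚ.toℚᵘ-fromℚᵘ (ℚᵘ.mkℚᵘ (posℤ k) 0)) ⟨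
  ℚᵘ.1ℚᵘ ℚᵘ.+ toℚᵘ (ℕtoℚ k)                  ≈⟨ ℚ.toℚᵘ-homo-+ 1ℚ (ℕtoℚ k) ⟨
  toℚᵘ (1ℚ + ℕtoℚ k)                         ∎)
  where open ℚᵘ.≃-Reasoning

count≡∑ : ∀ {A : Set} (p : A → Bool) xs → ℕtoℚ (length (filter (λ x → p x Bool.≟ true) xs)) ≡ ∑ xs (⟦_⟧ ∘ p)
count≡∑ p []       = refl
count≡∑ p (x ∷ xs) with p x
... | true  = trans (ℕtoℚ-suc (length (filter (λ x → p x Bool.≟ true) xs))) (cong (1ℚ +_) (count≡∑ p xs))
... | false = trans (count≡∑ p xs) (sym (ℚ.+-identityˡ _))

-- Moves the sum over subsets outside and separates the two tree variables, so that Möbius inversion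
-- can act on each factor alone.
∑-product : ∀ {A B C : Set} (m : A → ℚ) (k : B → ℚ) (c : C → ℚ) (f : C → A → ℚ) (g : C → B → ℚ) xs ys zs →
  ∑ xs (λ x → ∑ ys (λ y → (m x * k y) * ∑ zs (λ z → c z * (f z x * g z y)))) ≡
  ∑ zs (λ z → c z * (∑ xs (λ x → m x * f z x) * ∑ ys (λ y → k y * g z y)))
∑-product m k c f g xs ys zs = begin
  ∑ xs (λ x → ∑ ys (λ y → (m x * k y) * ∑ zs (λ z → c z * (f z x * g z y))))
    ≡⟨ ∑-cong xs (λ {x} _ → ∑-cong ys (λ {y} _ → ∑-*ˡ (m x * k y) _ zs)) ⟩
  ∑ xs (λ x → ∑ ys (λ y → ∑ zs (λ z → (m x * k y) * (c z * (f z x * g z y)))))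
    ≡⟨ ∑-cong xs (λ _ → ∑-swap _ ys zs) ⟩
  ∑ xs (λ x → ∑ zs (λ z → ∑ ys (λ y → (m x * k y) * (c z * (f z x * g z y)))))
    ≡⟨ ∑-swap _ xs zs ⟩
  ∑ zs (λ z → ∑ xs (λ x → ∑ ys (λ y → (m x * k y) * (c z * (f z x * g z y)))))
    ≡⟨ ∑-cong zs (λ {z} _ → factor z) ⟩
  ∑ zs (λ z → c z * (∑ xs (λ x → m x * f z x) * ∑ ys (λ y → k y * g z y))) ∎
  where
  open ≡-Reasoning
  rearrange : ∀ m k c f g → (m * k) * (c * (f * g)) ≡ (c * (m * f)) * (k * g)
  rearrange m k c f g = trans (cong ((m * k) *_) (sym (ℚ.*-assoc c f g)))
    (trans (*-Semigroup.interchange m k (c * f) g) (cong (_* (k * g)) (*-Semigroup.x∙yz≈y∙xz m c f)))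
  factor : ∀ z → ∑ xs (λ x → ∑ ys (λ y → (m x * k y) * (c z * (f z x * g z y)))) ≡
    c z * (∑ xs (λ x → m x * f z x) * ∑ ys (λ y → k y * g z y))
  factor z = begin
    ∑ xs (λ x → ∑ ys (λ y → (m x * k y) * (c z * (f z x * g z y))))
      ≡⟨ ∑-cong xs (λ {x} _ → ∑-cong ys (λ {y} _ → rearrange (m x) (k y) (c z) (f z x) (g z y))) ⟩
    ∑ xs (λ x → ∑ ys (λ y → (c z * (m x * f z x)) * (k y * g z y)))
      ≡⟨ ∑-cong xs (λ {x} _ → sym (∑-*ˡ (c z * (m x * f z x)) _ ys)) ⟩
    ∑ xs (λ x → (c z * (m x * f z x)) * K)  ≡⟨ sym (∑-*ʳ K _ xs) ⟩
    ∑ xs (λ x → c z * (m x * f z x)) * K    ≡⟨ cong (_* K) (sym (∑-*ˡ (c z) _ xs)) ⟩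
    (c z * ∑ xs (λ x → m x * f z x)) * K    ≡⟨ ℚ.*-assoc (c z) _ K ⟩
    c z * (∑ xs (λ x → m x * f z x) * K)    ∎
    where K = ∑ ys (λ y → k y * g z y)

-- Möbius inversion

_≼?_ : ∀ s t → Dec (s ≼ t)
s ≼? t = map′ (to ≤T⇔≼) (from ≤T⇔≼) (T? (s ≤T t))

⟦≤T⟧-yes : ∀ {s t} → s ≼ t → ⟦ s ≤T t ⟧ ≡ 1ℚ
⟦≤T⟧-yes {s} {t} p = ⟦⟧-yes {s ≤T t} (from ≤T⇔≼ p)

⟦≤T⟧-no : ∀ {s t} → ¬ s ≼ t → ⟦ s ≤T t ⟧ ≡ 0ℚ
⟦≤T⟧-no {s} {t} ¬p = ⟦⟧-no {s ≤T t} (¬p ∘ to ≤T⇔≼)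

δ-refl : ∀ t → δ t t ≡ 1ℚ
δ-refl t = ⟦⟧-yes {eqBT t t} (eqBT-refl t)

δ-≢ : ∀ {s t} → s ≢ t → δ s t ≡ 0ℚ
δ-≢ {s} {t} ne = ⟦⟧-no {eqBT s t} (ne ∘ eqBT-sound s t)

δ-sym : ∀ s t → δ s t ≡ δ t s
δ-sym s t with s ≟BT t
... | yes refl = refl
... | no ne    = trans (δ-≢ ne) (sym (δ-≢ (ne ∘ sym)))

private
  ¬T⇒≡false : ∀ {b} → ¬ T b → b ≡ false
  ¬T⇒≡false {true}  ¬t = contradiction tt ¬t
  ¬T⇒≡false {false} _  = refl

  eqBT-no : ∀ {s t} → s ≢ t → eqBT s t ≡ false
  eqBT-no {s} {t} ne = ¬T⇒≡false (ne ∘ eqBT-sound s t)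

strictlyBelow : BT → BT → BT → Bool
strictlyBelow s u v = (s ≤T v) ∧ ((v ≤T u) ∧ not (eqBT v u))

strictlyBelow⁻ : ∀ {s u v} → T (strictlyBelow s u v) → s ≼ v × v ≼ u × v ≢ u
strictlyBelow⁻ {s} {u} {v} p with q , p′ ← to (T-∧ {s ≤T v}) p with r , ne ← to (T-∧ {v ≤T u}) p′ =
  to ≤T⇔≼ q , to ≤T⇔≼ r , λ { refl → subst (T ∘ not) (to T-≡ (eqBT-refl v)) ne }

strictlyBelow⁺ : ∀ {s u v} → s ≼ v → v ≼ u → v ≢ u → T (strictlyBelow s u v)
strictlyBelow⁺ {s} {u} {v} p q ne = from (T-∧ {s ≤T v})
  (from ≤T⇔≼ p , from (T-∧ {v ≤T u}) (from ≤T⇔≼ q , subst (T ∘ not) (sym (eqBT-no ne)) tt))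

muF-refl : ∀ k s → muF k s s ≡ 1ℚ
muF-refl k s rewrite to T-≡ (eqBT-refl s) = refl

muF-≰ : ∀ k {s u} → ¬ s ≼ u → muF k s u ≡ 0ℚ
muF-≰ k {s} {u} ¬p rewrite eqBT-no {s} {u} (λ { refl → ¬p ε }) | ¬T⇒≡false {s ≤T u} (¬p ∘ to ≤T⇔≼) = refl

muF-< : ∀ k {s u} → s ≼ u → s ≢ u →
  muF (suc k) s u ≡ - ∑ (𝒴 (size s)) (λ v → if strictlyBelow s u v then muF k s v else 0ℚ)
muF-< k {s} {u} p ne rewrite eqBT-no ne | to T-≡ (from ≤T⇔≼ p) = refl

≼∧≢⇒weight : ∀ {s u} → s ≼ u → s ≢ u → weight u < weight s
≼∧≢⇒weight p ne with ≼-weight p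
... | inj₁ eq = contradiction eq ne
... | inj₂ lt = lt

-- The recursion replaces `u` by trees strictly below it, whose `downRank` is smaller; fuel beyond
-- that rank no longer changes the value.
muF-fuel : ∀ k k′ s u → downRank (size s) u ≤ k → downRank (size s) u ≤ k′ → muF k s u ≡ muF k′ s u
muF-fuel k k′ s u le le′ with s ≟BT u
... | yes refl = trans (muF-refl k s) (sym (muF-refl k′ s))
... | no ne with s ≼? u
... | no ¬p = trans (muF-≰ k ¬p) (sym (muF-≰ k′ ¬p))
-- `s` is heavier than `u`, so `downRank` is positive at `u` and neither fuel is exhausted.
... | yes p with lt ← downRank-< {size s} {s} {u} (∈-𝒴 s) (≼∧≢⇒weight p ne)
  with k | k′ | le | le′ | ≤-trans lt le | ≤-trans lt le′
... | suc k | suc k′ | le | le′ | _ | _ = trans (muF-< k p ne) (trans (cong -_ (∑-cong (𝒴 (size s)) term)) (sym (muF-< k′ p ne)))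
  where
  term : ∀ {v} → v ∈ 𝒴 (size s) →
    (if strictlyBelow s u v then muF k s v else 0ℚ) ≡ (if strictlyBelow s u v then muF k′ s v else 0ℚ)
  term {v} v∈ with strictlyBelow s u v in eq
  ... | false = refl
  ... | true with _ , q , ne′ ← strictlyBelow⁻ {s} {u} {v} (from T-≡ eq)
    with lt ← downRank-< {size s} {v} {u} v∈ (≼∧≢⇒weight q ne′) =
    muF-fuel k k′ s v (ℕ.≤-pred (≤-trans lt le)) (ℕ.≤-pred (≤-trans lt le′))

μ-refl : ∀ s → μ s s ≡ 1ℚ
μ-refl s = muF-refl (length (𝒴 (size s))) s

μ-≰ : ∀ {s u} → ¬ s ≼ u → μ s u ≡ 0ℚ
μ-≰ {s} = muF-≰ (length (𝒴 (size s)))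

μ-size : ∀ {s u} → size u ≢ size s → μ s u ≡ 0ℚ
μ-size ne = μ-≰ (λ p → ne (sym (≼-size p)))

-- Unfolding spends one unit of fuel inside the sum; `muF-fuel` restores it, so the recursion holds
-- for μ itself.
μ-< : ∀ {s u} → s ≼ u → s ≢ u → μ s u ≡ - ∑ (𝒴 (size s)) (λ v → if strictlyBelow s u v then μ s v else 0ℚ)
μ-< {s} {u} p ne = unfold (length (𝒴 (size s))) (length-filter _ (𝒴 (size s)))
  where
  unfold : ∀ N → downRank (size s) u ≤ N →
    muF N s u ≡ - ∑ (𝒴 (size s)) (λ v → if strictlyBelow s u v then μ s v else 0ℚ)
  unfold zero le = contradiction (≤-trans (downRank-< {size s} {s} {u} (∈-𝒴 s) (≼∧≢⇒weight p ne)) le) λ ()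
  unfold (suc N) le = trans (muF-< N p ne) (cong -_ (∑-cong (𝒴 (size s)) term))
    where
    term : ∀ {v} → v ∈ 𝒴 (size s) →
      (if strictlyBelow s u v then muF N s v else 0ℚ) ≡ (if strictlyBelow s u v then μ s v else 0ℚ)
    term {v} v∈ with strictlyBelow s u v in eq
    ... | false = refl
    ... | true with _ , q , ne′ ← strictlyBelow⁻ {s} {u} {v} (from T-≡ eq) =
      muF-fuel N (length (𝒴 (size s))) s v
        (ℕ.≤-pred (≤-trans (downRank-< {size s} {v} {u} v∈ (≼∧≢⇒weight q ne′)) le)) (length-filter _ (𝒴 (size s)))

-- The recursion for μ with the term at `u` moved to the other side. The sum runs over all trees of
-- the size of `s`; those outside the interval from `s` to `u` contribute zero.
μ-inversion : ∀ s u → ∑ (𝒴 (size s)) (λ v → μ s v * ⟦ v ≤T u ⟧) ≡ δ s u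
μ-inversion s u with s ≟BT u
... | yes refl = trans (∑-single (𝒴-unique (size s)) (∈-𝒴 s) other)
        (trans (cong₂ _*_ (μ-refl s) (⟦≤T⟧-yes {s} ε)) (sym (δ-refl s)))
  where
  other : ∀ {v} → v ∈ 𝒴 (size s) → v ≢ s → μ s v * ⟦ v ≤T s ⟧ ≡ 0ℚ
  other {v} _ ne with s ≼? v
  ... | no ¬p = 0*-≡0 _ (μ-≰ ¬p)
  ... | yes p = *0-≡0 (μ s v) (⟦≤T⟧-no (λ q → ne (≼-antisym q p)))
... | no ne with s ≼? u
... | no ¬p = trans (∑-zero (𝒴 (size s)) all-zero) (sym (δ-≢ ne))
  where
  all-zero : ∀ {v} → v ∈ 𝒴 (size s) → μ s v * ⟦ v ≤T u ⟧ ≡ 0ℚ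
  all-zero {v} _ with s ≼? v
  ... | no ¬q = 0*-≡0 _ (μ-≰ ¬q)
  ... | yes q = *0-≡0 (μ s v) (⟦≤T⟧-no (λ r → ¬p (q ◅◅ r)))
... | yes p = begin
  ∑ (𝒴 (size s)) (λ v → μ s v * ⟦ v ≤T u ⟧)  ≡⟨ ∑-cong (𝒴 (size s)) (λ {v} _ → split v) ⟩
  ∑ (𝒴 (size s)) (λ v → top v + below v)      ≡⟨ ∑-+ top below (𝒴 (size s)) ⟩
  ∑ (𝒴 (size s)) top + ∑ (𝒴 (size s)) below  ≡⟨ cong (_+ ∑ (𝒴 (size s)) below) top-sum ⟩
  μ s u + ∑ (𝒴 (size s)) below                ≡⟨ cong (_+ ∑ (𝒴 (size s)) below) (μ-< p ne) ⟩
  - ∑ (𝒴 (size s)) below + ∑ (𝒴 (size s)) below ≡⟨ ℚ.+-inverseˡ (∑ (𝒴 (size s)) below) ⟩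
  0ℚ                                            ≡⟨ δ-≢ ne ⟨
  δ s u                                         ∎
  where
  open ≡-Reasoning
  top below : BT → ℚ
  top v   = μ s v * δ v u
  below v = if strictlyBelow s u v then μ s v else 0ℚ
  top-sum : ∑ (𝒴 (size s)) top ≡ μ s u
  top-sum = trans (∑-single (𝒴-unique (size s)) (size⇒∈-𝒴 (sym (≼-size p))) (λ {v} _ ne′ → *0-≡0 (μ s v) (δ-≢ ne′)))
    (trans (cong (μ s u *_) (δ-refl u)) (ℚ.*-identityʳ (μ s u)))
  split : ∀ v → μ s v * ⟦ v ≤T u ⟧ ≡ top v + below v
  split v with v ≟BT u
  ... | yes refl = begin
    μ s v * ⟦ v ≤T v ⟧   ≡⟨ cong (μ s v *_) (trans (⟦≤T⟧-yes {v} ε) (sym (δ-refl v))) ⟩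
    top v                 ≡⟨ ℚ.+-identityʳ (top v) ⟨
    top v + 0ℚ            ≡⟨ cong (top v +_) (sym (not-below (λ t → proj₂ (proj₂ (strictlyBelow⁻ {s} {u} {v} t)) refl))) ⟩
    top v + below v       ∎
    where
    not-below : ¬ T (strictlyBelow s u v) → below v ≡ 0ℚ
    not-below ¬t rewrite ¬T⇒≡false ¬t = refl
  ... | no v≢u = trans below≡ (sym (trans (cong (_+ below v) (*0-≡0 (μ s v) (δ-≢ v≢u))) (ℚ.+-identityˡ (below v))))
    where
    below≡ : μ s v * ⟦ v ≤T u ⟧ ≡ below v
    below≡ with strictlyBelow s u v in eq
    ... | true = trans (cong (μ s v *_) (⟦≤T⟧-yes (proj₁ (proj₂ (strictlyBelow⁻ {s} {u} {v} (from T-≡ eq))))))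
                       (ℚ.*-identityʳ (μ s v))
    ... | false with s ≼? v | v ≼? u
    ... | no ¬q | _     = 0*-≡0 _ (μ-≰ ¬q)
    ... | yes _ | no ¬r = *0-≡0 (μ s v) (⟦≤T⟧-no ¬r)
    ... | yes q | yes r = case trans (sym eq) (to T-≡ (strictlyBelow⁺ q r v≢u)) of λ ()

-- The product in coordinates

-- `δ v` is the coordinate function of F_v. A vector confined to one degree is a finite combination
-- of these, a form to which linearity of `D r` applies.
∑-δ-expansion : ∀ n (x : Vect) → (∀ u → size u ≢ n → x u ≡ 0ℚ) → x ≗ (λ u → ∑ (𝒴 n) (λ v → x v * δ v u))
∑-δ-expansion n x supp u with size u ℕ.≟ n
... | yes eq = sym (trans (∑-single (𝒴-unique n) (size⇒∈-𝒴 eq) (λ {v} _ ne → *0-≡0 (x v) (δ-≢ ne)))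
                 (trans (cong (x u *_) (δ-refl u)) (ℚ.*-identityʳ (x u))))
... | no ne = trans (supp u ne) (sym (∑-zero (𝒴 n) (λ {v} v∈ → *0-≡0 (x v) (δ-≢ {v} {u} λ { refl → ne (∈-𝒴-size {n} v∈) }))))

module _ (s t : BT) where

  private
    n = size s ℕ.+ size t
    term : BT → BT → BT → ℚ
    term u s′ t′ = (μ s s′ * μ t t′) * prodF s′ t′ u

    term-zero : ∀ {p q s′ t′} u → s′ ∈ 𝒴 p → t′ ∈ 𝒴 q → ¬ (p ≡ size s × q ≡ size t) → term u s′ t′ ≡ 0ℚ
    term-zero {p} {q} {s′} {t′} u s′∈ t′∈ ne with size s′ ℕ.≟ size s | size t′ ℕ.≟ size t
    ... | no ne₁ | _      = 0*-≡0 _ (0*-≡0 _ (μ-size ne₁))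
    ... | yes _  | no ne₂ = 0*-≡0 _ (*0-≡0 (μ s s′) (μ-size ne₂))
    ... | yes e₁ | yes e₂ = contradiction (trans (sym (∈-𝒴-size {p} s′∈)) e₁ , trans (sym (∈-𝒴-size {q} t′∈)) e₂) ne

    by-left-size : BT → ℕ → ℚ
    by-left-size u p = ∑ (𝒴 p) (λ s′ → ∑ (𝒴 (size u ∸ p)) (term u s′))

    by-left-size-zero : ∀ u p → ¬ (p ≡ size s × size u ∸ p ≡ size t) → by-left-size u p ≡ 0ℚ
    by-left-size-zero u p ne = ∑-zero (𝒴 p) (λ s′∈ → ∑-zero (𝒴 (size u ∸ p)) (λ t′∈ → term-zero u s′∈ t′∈ ne))

  ⋆-support : ∀ u → size u ≢ n → (M s ⋆ M t) u ≡ 0ℚ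
  ⋆-support u ne = ∑-zero (upTo (suc (size u))) (λ {p} p∈ → by-left-size-zero u p (λ (e , e′) →
    -- Here `p` is at most `size u`, so the truncated subtraction is exact and the two degrees add
    -- up to `size u`.
    ne (trans (sym (ℕ.m+[n∸m]≡n (ℕ.≤-pred (∈-upTo⁻ p∈)))) (cong₂ ℕ._+_ e e′))))

  -- `_⋆_` sums over every left degree up to `size u`, but M_s and M_t vanish outside their own
  -- degrees, so only the left degree `size s` survives.
  ⋆-coefficient : ∀ u → size u ≡ n → (M s ⋆ M t) u ≡
    ∑ (𝒴 (size s)) (λ s′ → ∑ (𝒴 (size t)) (λ t′ → (μ s s′ * μ t t′) * prodF s′ t′ u))
  ⋆-coefficient u eq = trans
    (∑-single {f = by-left-size u} (Unique.upTo⁺ (suc (size u)))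
      (∈-upTo⁺ (s≤s (subst (size s ≤_) (sym eq) (ℕ.m≤m+n (size s) (size t)))))
      (λ {p} _ ne → by-left-size-zero u p (ne ∘ proj₁)))
    (cong (λ q → ∑ (𝒴 (size s)) (λ s′ → ∑ (𝒴 q) (term u s′)))
      (trans (cong (_∸ size s) eq) (ℕ.m+n∸m≡n (size s) (size t))))

length-Sh : ∀ p q {ζ} → ζ ∈ Sh p q → length ζ ≡ p ℕ.+ q
length-Sh p q ζ∈ = trans (↭-length (∈-perms⁻ n (proj₁ (∈-filter⁻ _ {xs = perms n} ζ∈)))) (length-oneTo n)
  where n = p ℕ.+ q

size-lam-productWord : ∀ s t ζ → size (lam (productWord s t ζ)) ≡ length ζ
size-lam-productWord s t ζ = begin
  size (lam (productWord s t ζ))  ≡⟨ size-lam (productWord s t ζ) ⟩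
  length (productWord s t ζ)      ≡⟨ length-map _ (inv ζ) ⟩
  length (inv ζ)                  ≡⟨ length-map _ (oneTo (length ζ)) ⟩
  length (oneTo (length ζ))       ≡⟨ length-oneTo (length ζ) ⟩
  length ζ                        ∎
  where open ≡-Reasoning

-- Each shuffle yields one tree, so after exchanging the sums it keeps a single term. The counts in
-- `prodF` become indicators over shuffles, ready to be compared with subsets.
∑-prodF : ∀ s t r → ∑ (𝒴 (size s ℕ.+ size t)) (λ u → prodF s t u * ⟦ u ≤T r ⟧) ≡
  ∑ (Sh (size s) (size t)) (λ ζ → ⟦ lam (productWord s t ζ) ≤T r ⟧)
∑-prodF s t r = begin
  ∑ Y (λ u → prodF s t u * ⟦ u ≤T r ⟧)
    ≡⟨ ∑-cong Y (λ {u} _ → trans (cong (_* ⟦ u ≤T r ⟧) (count≡∑ (λ ζ → eqBT (tree ζ) u) S)) (∑-*ʳ ⟦ u ≤T r ⟧ _ S)) ⟩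
  ∑ Y (λ u → ∑ S (λ ζ → δ (tree ζ) u * ⟦ u ≤T r ⟧))  ≡⟨ ∑-swap _ Y S ⟩
  ∑ S (λ ζ → ∑ Y (λ u → δ (tree ζ) u * ⟦ u ≤T r ⟧))  ≡⟨ ∑-cong S (λ {ζ} ζ∈ → at-tree ζ ζ∈) ⟩
  ∑ S (λ ζ → ⟦ tree ζ ≤T r ⟧)                        ∎
  where
  open ≡-Reasoning
  Y = 𝒴 (size s ℕ.+ size t)
  S = Sh (size s) (size t)
  tree : Perm → BT
  tree ζ = lam (productWord s t ζ)
  at-tree : ∀ ζ → ζ ∈ S → ∑ Y (λ u → δ (tree ζ) u * ⟦ u ≤T r ⟧) ≡ ⟦ tree ζ ≤T r ⟧
  at-tree ζ ζ∈ = trans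
    (∑-single (𝒴-unique (size s ℕ.+ size t))
      (size⇒∈-𝒴 (trans (size-lam-productWord s t ζ) (length-Sh (size s) (size t) ζ∈)))
      (λ {u} _ ne → 0*-≡0 ⟦ u ≤T r ⟧ (δ-≢ (ne ∘ sym))))
    (trans (cong (_* ⟦ tree ζ ≤T r ⟧) (δ-refl (tree ζ))) (ℚ.*-identityˡ _))

countTrue-complement : ∀ R → countTrue R ℕ.+ countTrue (complement R) ≡ length R
countTrue-complement []          = refl
countTrue-complement (true  ∷ R) = cong suc (countTrue-complement R)
countTrue-complement (false ∷ R) = trans (ℕ.+-suc (countTrue R) _) (cong suc (countTrue-complement R))

-- The coefficient of M_r in F_s · F_t.
∑-Sh : ∀ s t r → ∑ (Sh (size s) (size t)) (λ ζ → ⟦ lam (productWord s t ζ) ≤T r ⟧) ≡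
  ∑ (subsets (size r)) (λ R → ⟦ lam (piR R) ≤T r ⟧ * (⟦ s ≤T restrictT r R ⟧ * ⟦ t ≤T restrictT r (complement R) ⟧))
∑-Sh s t r with size r ℕ.≟ size s ℕ.+ size t
... | no ne = trans
  (∑-zero (Sh (size s) (size t)) (λ {ζ} ζ∈ → ⟦≤T⟧-no (λ p →
    ne (trans (sym (≼-size p)) (trans (size-lam-productWord s t ζ) (length-Sh (size s) (size t) ζ∈))))))
  (sym (∑-zero (subsets (size r)) (λ {R} R∈ → *0-≡0 ⟦ lam (piR R) ≤T r ⟧ (pair-zero R (∈-subsets⁻ (size r) R∈)))))
  where
  pair-zero : ∀ R → length R ≡ size r → ⟦ s ≤T restrictT r R ⟧ * ⟦ t ≤T restrictT r (complement R) ⟧ ≡ 0ℚ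
  pair-zero R len with s ≼? restrictT r R | t ≼? restrictT r (complement R)
  ... | no ¬p | _     = 0*-≡0 _ (⟦≤T⟧-no ¬p)
  ... | yes _ | no ¬q = *0-≡0 ⟦ s ≤T restrictT r R ⟧ (⟦≤T⟧-no ¬q)
  ... | yes p | yes q = contradiction (sym (begin
    size s ℕ.+ size t                                              ≡⟨ cong₂ ℕ._+_ (≼-size p) (≼-size q) ⟩
    size (restrictT r R) ℕ.+ size (restrictT r (complement R))     ≡⟨ cong₂ ℕ._+_ (size-restrictT r R len)
      (size-restrictT r (complement R) (trans (length-map not R) len)) ⟩
    countTrue R ℕ.+ countTrue (complement R)                       ≡⟨ countTrue-complement R ⟩
    length R                                                       ≡⟨ len ⟩
    size r                                                         ∎)) ne
    where open ≡-Reasoning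
... | yes sz = begin
  ∑ (Sh (size s) (size t)) f                     ≡⟨ ∑-↭ f (Sh-↭ (size s) (size t)) ⟩
  ∑ (shufflesOf (size s) (size t)) f             ≡⟨ ∑-map shuffleOf f filtered ⟩
  ∑ filtered (f ∘ shuffleOf)                     ≡⟨ ∑-cong filtered (λ {R} i →
    let R∈ , ct = ∈-filter⁻ _ {xs = subsets n} i in term R ct (∈-subsets⁻ n R∈)) ⟩
  ∑ filtered g                                   ≡⟨ ∑-filter _ (subsets n) (λ {R} R∈ → wrong-size R (∈-subsets⁻ n R∈)) ⟩
  ∑ (subsets n) g                                ≡⟨ cong (λ k → ∑ (subsets k) g) (sym sz) ⟩
  ∑ (subsets (size r)) g                         ∎
  where
  open ≡-Reasoning
  n = size s ℕ.+ size t
  filtered = filter (λ R → countTrue R ℕ.≟ size s) (subsets n)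
  f : Perm → ℚ
  f ζ = ⟦ lam (productWord s t ζ) ≤T r ⟧
  g : List Bool → ℚ
  g R = ⟦ lam (piR R) ≤T r ⟧ * (⟦ s ≤T restrictT r R ⟧ * ⟦ t ≤T restrictT r (complement R) ⟧)
  term : ∀ R → countTrue R ≡ size s → length R ≡ n → f (shuffleOf R) ≡ g R
  term R ct len = trans (cong ⟦_⟧ (productWord-≤T s t r R ct len sz))
    (trans (⟦⟧-∧ (lam (piR R) ≤T r) _) (cong (⟦ lam (piR R) ≤T r ⟧ *_) (⟦⟧-∧ (s ≤T restrictT r R) _)))
  wrong-size : ∀ R → length R ≡ n → countTrue R ≢ size s → g R ≡ 0ℚ
  wrong-size R len ne = *0-≡0 ⟦ lam (piR R) ≤T r ⟧ (0*-≡0 _ (⟦≤T⟧-no (λ p →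
    ne (trans (sym (size-restrictT r R (trans len (sym sz)))) (sym (≼-size p))))))

-- Linear functionals dual to the monomial basis

module _ (D : BT → Vect → ℚ)
  (D-+ : ∀ r x y → D r (x +v y) ≡ D r x + D r y)
  (D-· : ∀ r c x → D r (c ·v x) ≡ c * D r x)
  (D-cong : ∀ r x y → x ≗ y → D r x ≡ D r y)
  (D-M : ∀ r u → D r (M u) ≡ δ r u) where

  D-∑ : ∀ {A : Set} r (c : A → ℚ) (f : A → Vect) xs →
    D r (λ u → ∑ xs (λ x → c x * f x u)) ≡ ∑ xs (λ x → c x * D r (f x))
  -- The empty sum is the zero vector, written as a zero multiple so that `D-·` gives its value.
  D-∑ r c f []       = trans (D-cong r _ (0ℚ ·v δ r) (λ u → sym (ℚ.*-zeroˡ (δ r u)))) (trans (D-· r 0ℚ (δ r)) (ℚ.*-zeroˡ (D r (δ r))))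
  D-∑ r c f (x ∷ xs) = trans (D-+ r (c x ·v f x) _) (cong₂ _+_ (D-· r (c x) (f x)) (D-∑ r c f xs))

  D-expansion : ∀ r n (x : Vect) → (∀ u → size u ≢ n → x u ≡ 0ℚ) → D r x ≡ ∑ (𝒴 n) (λ v → x v * D r (δ v))
  D-expansion r n x supp = trans (D-cong r x _ (∑-δ-expansion n x supp)) (D-∑ r x δ (𝒴 n))

  -- Both sides have the same Möbius transform, and μ is unitriangular.
  D-F : ∀ r v → D r (δ v) ≡ ⟦ v ≤T r ⟧
  D-F r v = induction (suc (weight v)) v ≤-refl
    where
    induction : ∀ k v → weight v < k → D r (δ v) ≡ ⟦ v ≤T r ⟧
    induction (suc k) v (s≤s le) = begin
      D r (δ v)            ≡⟨ ℚ.*-identityˡ (D r (δ v)) ⟨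
      1ℚ * D r (δ v)       ≡⟨ cong (_* D r (δ v)) (μ-refl v) ⟨
      μ v v * D r (δ v)    ≡⟨ ∑-isolate (𝒴-unique (size v)) (∈-𝒴 v) (λ {w} _ → other w) transforms ⟩
      μ v v * ⟦ v ≤T r ⟧   ≡⟨ cong (_* ⟦ v ≤T r ⟧) (μ-refl v) ⟩
      1ℚ * ⟦ v ≤T r ⟧      ≡⟨ ℚ.*-identityˡ ⟦ v ≤T r ⟧ ⟩
      ⟦ v ≤T r ⟧           ∎
      where
      open ≡-Reasoning
      transforms : ∑ (𝒴 (size v)) (λ w → μ v w * D r (δ w)) ≡ ∑ (𝒴 (size v)) (λ w → μ v w * ⟦ w ≤T r ⟧)
      transforms = begin
        ∑ (𝒴 (size v)) (λ w → μ v w * D r (δ w))  ≡⟨ D-expansion r (size v) (M v) (λ u → μ-size) ⟨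
        D r (M v)                                  ≡⟨ D-M r v ⟩
        δ r v                                      ≡⟨ δ-sym r v ⟩
        δ v r                                      ≡⟨ μ-inversion v r ⟨
        ∑ (𝒴 (size v)) (λ w → μ v w * ⟦ w ≤T r ⟧) ∎
      other : ∀ w → w ≢ v → μ v w * D r (δ w) ≡ μ v w * ⟦ w ≤T r ⟧
      other w ne with v ≼? w
      ... | no ¬p = trans (0*-≡0 _ (μ-≰ ¬p)) (sym (0*-≡0 _ (μ-≰ ¬p)))
      -- From `v ≼ w` and `w ≢ v` the weight of `w` is smaller: the induction comes down from the
      -- top of the order.
      ... | yes p = cong (μ v w *_) (induction k w (<-≤-trans (≼∧≢⇒weight p (ne ∘ sym)) le))

  -- The detour through the F basis is forced, since the product is given only there; `D-F` turns
  -- the value at F_u into the indicator of `u ≼ r`.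
  D-⋆ : ∀ r s t → D r (M s ⋆ M t) ≡ ∑ (𝒴 (size s)) (λ s′ → ∑ (𝒴 (size t)) (λ t′ →
    (μ s s′ * μ t t′) * ∑ (Sh (size s′) (size t′)) (λ ζ → ⟦ lam (productWord s′ t′ ζ) ≤T r ⟧)))
  D-⋆ r s t = begin
    D r (M s ⋆ M t)
      ≡⟨ D-expansion r n (M s ⋆ M t) (⋆-support s t) ⟩
    ∑ Y (λ u → (M s ⋆ M t) u * D r (δ u))
      ≡⟨ ∑-cong Y (λ {u} u∈ → cong₂ _*_ (⋆-coefficient s t u (∈-𝒴-size {n} u∈)) (D-F r u)) ⟩
    ∑ Y (λ u → ∑ S (λ s′ → ∑ U (λ t′ → c s′ t′ * prodF s′ t′ u)) * ⟦ u ≤T r ⟧)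
      ≡⟨ ∑-cong Y (λ {u} _ → trans (∑-*ʳ ⟦ u ≤T r ⟧ _ S) (∑-cong S (λ {s′} _ →
           trans (∑-*ʳ ⟦ u ≤T r ⟧ _ U) (∑-cong U (λ {t′} _ → ℚ.*-assoc (c s′ t′) (prodF s′ t′ u) ⟦ u ≤T r ⟧))))) ⟩
    ∑ Y (λ u → ∑ S (λ s′ → ∑ U (λ t′ → c s′ t′ * (prodF s′ t′ u * ⟦ u ≤T r ⟧))))
      ≡⟨ trans (∑-swap _ Y S) (∑-cong S (λ _ → ∑-swap _ Y U)) ⟩
    ∑ S (λ s′ → ∑ U (λ t′ → ∑ Y (λ u → c s′ t′ * (prodF s′ t′ u * ⟦ u ≤T r ⟧))))
      ≡⟨ ∑-cong S (λ {s′} s′∈ → ∑-cong U (λ {t′} t′∈ → trans (sym (∑-*ˡ (c s′ t′) _ Y)) (cong (c s′ t′ *_)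
           (trans (cong (λ k → ∑ (𝒴 k) (λ u → prodF s′ t′ u * ⟦ u ≤T r ⟧))
                    (sym (cong₂ ℕ._+_ (∈-𝒴-size {size s} s′∈) (∈-𝒴-size {size t} t′∈))))
             (∑-prodF s′ t′ r))))) ⟩
    ∑ S (λ s′ → ∑ U (λ t′ → c s′ t′ * ∑ (Sh (size s′) (size t′)) (λ ζ → ⟦ lam (productWord s′ t′ ζ) ≤T r ⟧))) ∎
    where
    open ≡-Reasoning
    n = size s ℕ.+ size t
    Y = 𝒴 n
    S = 𝒴 (size s)
    U = 𝒴 (size t)
    c : BT → BT → ℚ
    c s′ t′ = μ s s′ * μ t t′

-- `D r` stands for M*_r, fixed on finite combinations by linearity and its values on the monomial
-- basis. By duality Δ(M*_r) takes on M_s ⊗ M_t the value of M*_r on M_s · M_t, and these values for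
-- all `s` and `t` determine the coproduct.
theorem8p6 : (D : BT → Vect → ℚ)
    → (∀ r x y → D r (x +v y) ≡ D r x + D r y)
    → (∀ r c x → D r (c ·v x) ≡ c * D r x)
    → (∀ r x y → x ≗ y → D r x ≡ D r y)
    → (∀ r u → D r (M u) ≡ δ r u)
    → ∀ (r s t : BT)
    → D r (M s ⋆ M t)
      ≡ sumℚ (map (λ R → if lam (piR R) ≤T r
                           then D (restrictT r R) (M s) * D (restrictT r (complement R)) (M t)
                           else 0ℚ)
                  (subsets (size r)))
theorem8p6 D D-+ D-· D-cong D-M r s t = begin
  D r (M s ⋆ M t)
    ≡⟨ D-⋆ D D-+ D-· D-cong D-M r s t ⟩
  ∑ (𝒴 (size s)) (λ s′ → ∑ (𝒴 (size t)) (λ t′ →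
    (μ s s′ * μ t t′) * ∑ (Sh (size s′) (size t′)) (λ ζ → ⟦ lam (productWord s′ t′ ζ) ≤T r ⟧)))
    ≡⟨ ∑-cong (𝒴 (size s)) (λ {s′} _ → ∑-cong (𝒴 (size t)) (λ {t′} _ → cong ((μ s s′ * μ t t′) *_) (∑-Sh s′ t′ r))) ⟩
  ∑ (𝒴 (size s)) (λ s′ → ∑ (𝒴 (size t)) (λ t′ → (μ s s′ * μ t t′) * ∑ (subsets (size r)) (λ R →
    ⟦ lam (piR R) ≤T r ⟧ * (⟦ s′ ≤T restrictT r R ⟧ * ⟦ t′ ≤T restrictT r (complement R) ⟧))))
    ≡⟨ ∑-product (μ s) (μ t) (λ R → ⟦ lam (piR R) ≤T r ⟧) (λ R s′ → ⟦ s′ ≤T restrictT r R ⟧)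
         (λ R t′ → ⟦ t′ ≤T restrictT r (complement R) ⟧) (𝒴 (size s)) (𝒴 (size t)) (subsets (size r)) ⟩
  ∑ (subsets (size r)) (λ R → ⟦ lam (piR R) ≤T r ⟧ *
    (∑ (𝒴 (size s)) (λ s′ → μ s s′ * ⟦ s′ ≤T restrictT r R ⟧) *
     ∑ (𝒴 (size t)) (λ t′ → μ t t′ * ⟦ t′ ≤T restrictT r (complement R) ⟧)))
    ≡⟨ ∑-cong (subsets (size r)) (λ {R} _ → trans
         (cong (⟦ lam (piR R) ≤T r ⟧ *_) (cong₂ _*_ (dual s (restrictT r R)) (dual t (restrictT r (complement R)))))
         (sym (if-⟦⟧ (lam (piR R) ≤T r)))) ⟩
  ∑ (subsets (size r)) (λ R → if lam (piR R) ≤T r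
    then D (restrictT r R) (M s) * D (restrictT r (complement R)) (M t) else 0ℚ) ∎
  where
  open ≡-Reasoning
  -- The Möbius sum of indicators collapses to δ, which is also the value on M_s of the functional
  -- dual to M_u.
  dual : ∀ s u → ∑ (𝒴 (size s)) (λ v → μ s v * ⟦ v ≤T u ⟧) ≡ D u (M s)
  dual s u = trans (μ-inversion s u) (trans (δ-sym s u) (sym (D-M u s)))
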